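{- Let $p \ge 3$ and $k \ge p+2$ be positive integers, and let $\Pi \subseteq S_k$ with $|\Pi| = p$. Then $\Pi$ is not symmetrically avoided; that is, there exists $n$ such that the set $S_n(\Pi)$ is not symmetric.
   Context: $S_n$ is the symmetric group on $[n]=\{1,\dots,n\}$, with permutations written in one-line notation $\sigma=[\sigma_1,\dots,\sigma_n]$. For $\pi\in S_k$ and $\sigma\in S_n$, $\sigma$ contains the pattern $\pi$ if there are indices $1\le i_1<\dots<i_k\le n$ such that for all $1\le j<j'\le k$, $\pi_j<\pi_{j'}\iff \sigma_{i_j}<\sigma_{i_{j'}}$; otherwise (or if $k>n$) $\sigma$ avoids $\pi$. $S_n(\Pi)$ is the set of permutations in $S_n$ avoiding every $\pi\in\Pi$. The descent set of $\pi\in S_n$ is $\operatorname{Des}(\pi)=\{i\in[n-1]:\pi_i>\pi_{i+1}\}$. For $S\subseteq[n-1]$, the fundamental quasisymmetric function is $F_S=\sum x_{i_1}x_{i_2}\cdots x_{i_n}$, summed over $i_1\le i_2\le\dots\le i_n$ (positive integers) with $i_j<i_{j+1}$ for all $j\in S$. For a set $A\subseteq S_n$, its quasisymmetric generating function is $\mathcal{Q}_n(A)=\sum_{\pi\in A}F_{\operatorname{Des}(\pi)}$, and $A$ is called symmetric if $\mathcal{Q}_n(A)$ is a symmetric function. A set $\Pi\subseteq S_k$ is symmetrically avoided if $S_n(\Pi)$ is symmetric for all $n$. -}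

module Defs where

open import Data.Nat as ℕ using (ℕ; zero; suc; _<_; _≤_)
open import Data.Fin as F using (Fin; toℕ)
open import Data.Vec using (Vec; []; _∷_; lookup; tabulate)
open import Data.List using (List; []; _∷_; _++_; replicate; length; map; concatMap; allFin)
open import Data.List.Relation.Unary.All using (All)
open import Data.Product using (Σ; _×_; _,_)
open import Relation.Binary.PropositionalEquality using (_≡_)
open import Relation.Nullary using (¬_)
open import Function.Bundles using (_⇔_)

-- Permutations of [n] in one-line notation, 0-based: σ = (σ₀,…,σ_{n-1})
-- with σᵢ ∈ Fin n; σ is a permutation iff i ↦ σᵢ is injective.
IsPerm : ∀ {n} → Vec (Fin n) n → Set
IsPerm {n} σ = ∀ (i j : Fin n) → lookup σ i ≡ lookup σ j → i ≡ j

Contains : ∀ {k n} → Vec (Fin k) k → Vec (Fin n) n → Set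
Contains {k} {n} π σ =
  Σ (Fin k → Fin n) λ f →
    (∀ (j j' : Fin k) → j F.< j' → f j F.< f j') ×
    (∀ (j j' : Fin k) → j F.< j' →
       (lookup π j F.< lookup π j' ⇔ lookup σ (f j) F.< lookup σ (f j')))

Avoids : ∀ {k n} → Vec (Fin k) k → Vec (Fin n) n → Set
Avoids π σ = ¬ Contains π σ

AvoidsAll : ∀ {k n} → List (Vec (Fin k) k) → Vec (Fin n) n → Set
AvoidsAll Π σ = All (λ π → Avoids π σ) Π

IsDescent : ∀ {n} → Vec (Fin n) n → Fin n → Fin n → Set
IsDescent σ i j = (toℕ j ≡ suc (toℕ i)) × (lookup σ j F.< lookup σ i)

allVecs : ∀ {A : Set} → List A → (n : ℕ) → List (Vec A n)
allVecs xs zero = [] ∷ []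
allVecs xs (suc n) = concatMap (λ x → map (x ∷_) (allVecs xs n)) xs

-- the list of all σ : Vec (Fin n) n (each exactly once); S_n is the
-- sublist of those satisfying IsPerm.
allMaps : (n : ℕ) → List (Vec (Fin n) n)
allMaps n = allVecs (allFin n) n

-- Monomials: variables x₀, x₁, …; a monomial in the first m variables is an
-- exponent vector e : Vec ℕ m.  Its weakly increasing index word is
-- 0^{e₀} 1^{e₁} … (m-1)^{e_{m-1}}.
wordFrom : ∀ {m} → ℕ → Vec ℕ m → List ℕ
wordFrom j [] = []
wordFrom j (e ∷ es) = replicate e j ++ wordFrom (suc j) es

word : ∀ {m} → Vec ℕ m → List ℕ
word = wordFrom 0

-- ℕ-indexed list access with default 0 (only used within bounds)
at : List ℕ → ℕ → ℕ
at [] _ = 0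
at (x ∷ xs) zero = x
at (x ∷ xs) (suc i) = at xs i

-- The coefficient of x^e in F_{Des σ} is 1 iff the (unique) weakly increasing
-- index sequence i₁ ≤ … ≤ i_n with x_{i₁}⋯x_{i_n} = x^e exists (degree n)
-- and is strict at every descent of σ; otherwise it is 0.
FTerm : ∀ {n m} → Vec (Fin n) n → Vec ℕ m → Set
FTerm {n} σ e =
  (length (word e) ≡ n) ×
  (∀ (i j : Fin n) → IsDescent σ i j → at (word e) (toℕ i) < at (word e) (toℕ j))

data Count {A : Set} (P : A → Set) : List A → ℕ → Set where
  nil  : Count P [] 0
  yes  : ∀ {x xs c} → P x → Count P xs c → Count P (x ∷ xs) (suc c)
  no   : ∀ {x xs c} → ¬ P x → Count P xs c → Count P (x ∷ xs) c

-- Coefficient of x^e in Q_n(S_n(Π)) = Σ_{σ ∈ S_n(Π)} F_{Des σ} is c.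
QCoeff : ∀ {k} → List (Vec (Fin k) k) → (n : ℕ) → ∀ {m} → Vec ℕ m → ℕ → Set
QCoeff Π n e c =
  Count (λ σ → IsPerm σ × AvoidsAll Π σ × FTerm σ e) (allMaps n) c

permuteExp : ∀ {m} → Vec ℕ m → Vec (Fin m) m → Vec ℕ m
permuteExp e τ = tabulate (λ j → lookup e (lookup τ j))

-- Q_n(S_n(Π)) is symmetric: its coefficients are invariant under every
-- permutation of (finitely many) variables.
IsSymmetric : ∀ {k} → List (Vec (Fin k) k) → ℕ → Set
IsSymmetric Π n =
  ∀ (m : ℕ) (e : Vec ℕ m) (τ : Vec (Fin m) m) → IsPerm τ →
  ∀ (c : ℕ) → QCoeff Π n e c → QCoeff Π n (permuteExp e τ) c

SymmetricallyAvoided : ∀ {k} → List (Vec (Fin k) k) → Set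
SymmetricallyAvoided Π = ∀ n → IsSymmetric Π n

{-# OPTIONS --safe #-}

-- Already n = k fails. There S_k(Π) is the complement of Π, and S_k itself is symmetric, so
-- the coefficients Σ_{π ∈ Π} [x^e] F_{Des π} are invariant under permuting e. Write u_π(i) = 1
-- if π ascends at i and 0 otherwise, 0 ≤ i < k - 1. Taking e to be a rearrangement of (2,1,…,1),
-- (3,1,…,1) or (2,2,1,…,1) shows that Σ_π u_π(i) u_π(j) is B + b if i = j, B - c if ∣i - j∣ = 1,
-- and B otherwise, whence
--   Σ_π (Σ_i x_i u_π(i))² = B (Σ x_i)² + b Σ x_i² - 2 c Σ x_i x_{i+1}.
-- If b + c = 0, all ascent columns coincide, every π ∈ Π is monotone and ∣Π∣ ≤ 2.  Otherwise
-- b ≥ 1 and b + 2 c ≥ 0.  When 2 c ≤ b, the form is definite on Σ x_i = 0; but ∣Π∣ < k - 1 yields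
-- a nonzero integer vector orthogonal to all rows u_π, on which the form vanishes.  When 2 c > b,
-- the vector (1^{r+1}, 0, (-1)^r) with r ≈ k/2 forces b ≥ 2 r - 1, which is incompatible with
-- 3 b + 2 c ≤ ∣Π∣.
module Submission where

open import Defs hiding (yes; no)
open import Data.Nat as ℕ using (ℕ; zero; suc; s≤s; z≤n)
import Data.Nat.Properties as ℕₚ
open import Data.Integer using (ℤ; +_; -[1+_]; 0ℤ; 1ℤ; -1ℤ; _+_; _-_; _*_; -_; _≤_; +≤+)
import Data.Integer.Properties as ℤₚ
open import Data.Integer.Tactic.RingSolver using (solve-∀)
open import Data.Fin as F using (Fin; zero; suc; toℕ; inject₁; opposite; punchOut; fromℕ<)
import Data.Fin.Properties as Fₚ
open import Data.Fin.Permutation as Perm using (Permutation; _⟨$⟩ʳ_; _⟨$⟩ˡ_; _∘ₚ_; transpose; inverseˡ)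
open import Data.List as List using (List; []; _∷_; _++_; length; map; filter; concatMap; cartesianProductWith)
import Data.List.Properties as Listₚ
open import Data.List.Relation.Unary.All as All using (All; []; _∷_)
import Data.List.Relation.Unary.All.Properties as Allₚ
open import Data.List.Relation.Unary.AllPairs as AllPairs using ([]; _∷_)
open import Data.List.Relation.Unary.Any using (here; there)
open import Data.List.Relation.Unary.Linked using (Linked; [-]; _∷_)
open import Data.List.Relation.Unary.Linked.Properties using (Linked⇒AllPairs)
open import Data.List.Relation.Unary.Unique.Propositional using (Unique)
import Data.List.Relation.Unary.Unique.Propositional.Properties as Uniqueₚ
open import Data.List.Membership.Propositional using (_∈_; _∉_)
import Data.List.Membership.Propositional.Properties as ∈ₚ
open import Data.List.Membership.Propositional.Properties.WithK using (unique∧set⇒bag)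
open import Data.List.Relation.Binary.BagAndSetEquality using (∼bag⇒↭)
open import Data.List.Relation.Binary.Permutation.Propositional using (_↭_; ↭-refl; ↭-sym; prep; swap; trans)
open import Data.List.Relation.Binary.Permutation.Propositional.Properties using (All-resp-↭; ↭-length)
open import Data.Vec as Vec using (Vec; []; _∷_; lookup; tabulate; _[_]≔_)
import Data.Vec.Properties as Vecₚ
import Data.Vec.Relation.Unary.All as VAll
open import Data.Product using (Σ; ∃; ∃₂; _×_; _,_; proj₁; proj₂)
open import Data.Sum using (_⊎_; inj₁; inj₂)
open import Data.Empty using (⊥; ⊥-elim)
open import Function using (_∘_; id; _⇔_; mk⇔; Equivalence)
open import Relation.Nullary using (¬_; Dec; yes; no; contradiction; ¬?)
open import Relation.Nullary.Decidable using (_×-dec_; _→-dec_)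
open import Relation.Unary using (Decidable)
open import Relation.Binary using (tri<; tri≈; tri>)
open import Relation.Binary.PropositionalEquality as ≡ using (_≡_; _≢_; refl; sym; cong; cong₂; subst; module ≡-Reasoning)

open Equivalence using (to; from)

private variable
  A : Set

-- Sums over lists

∑ : List A → (A → ℤ) → ℤ
∑ []       f = 0ℤ
∑ (r ∷ rs) f = f r + ∑ rs f

∑-cong : ∀ (rs : List A) {f g} → (∀ r → f r ≡ g r) → ∑ rs f ≡ ∑ rs g
∑-cong []       eq = refl
∑-cong (r ∷ rs) eq = cong₂ _+_ (eq r) (∑-cong rs eq)

∑-+ : ∀ (rs : List A) f g → ∑ rs (λ r → f r + g r) ≡ ∑ rs f + ∑ rs g
∑-+ []       f g = refl
∑-+ (r ∷ rs) f g = ≡.trans (cong (_+_ (f r + g r)) (∑-+ rs f g)) (lem (f r) (g r) _ _)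
  where
  lem : ∀ a b c d → a + b + (c + d) ≡ a + c + (b + d)
  lem = solve-∀

∑-* : ∀ (rs : List A) k f → ∑ rs (λ r → k * f r) ≡ k * ∑ rs f
∑-* []       k f = sym (ℤₚ.*-zeroʳ k)
∑-* (r ∷ rs) k f = ≡.trans (cong (_+_ (k * f r)) (∑-* rs k f)) (sym (ℤₚ.*-distribˡ-+ k _ _))

∑-- : ∀ (rs : List A) f g → ∑ rs (λ r → f r - g r) ≡ ∑ rs f - ∑ rs g
∑-- []       f g = refl
∑-- (r ∷ rs) f g = ≡.trans (cong (_+_ (f r - g r)) (∑-- rs f g)) (lem (f r) (g r) _ _)
  where
  lem : ∀ a b c d → a - b + (c - d) ≡ a + c - (b + d)
  lem = solve-∀

∑-1 : ∀ (rs : List A) → ∑ rs (λ _ → 1ℤ) ≡ + length rs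
∑-1 []       = refl
∑-1 (r ∷ rs) = cong (_+_ 1ℤ) (∑-1 rs)

∑-0 : ∀ (rs : List A) {f} → All (λ r → f r ≡ 0ℤ) rs → ∑ rs f ≡ 0ℤ
∑-0 []       []       = refl
∑-0 (r ∷ rs) (e ∷ es) = cong₂ _+_ e (∑-0 rs es)

-- Nonnegativity certificates

infixl 6 _⊕_
infixl 7 _⊗_

_⊕_ : ∀ {x y} → 0ℤ ≤ x → 0ℤ ≤ y → 0ℤ ≤ x + y
_⊕_ = ℤₚ.+-mono-≤

_⊗_ : ∀ {x y} → 0ℤ ≤ x → 0ℤ ≤ y → 0ℤ ≤ x * y
_⊗_ {+ m} {+ n} _ _ = subst (0ℤ ≤_) (ℤₚ.pos-* m n) (+≤+ z≤n)

0≤+ : ∀ n → 0ℤ ≤ + n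
0≤+ n = +≤+ z≤n

-- Certificates are assembled with `_⊕_` and `_⊗_` and then moved along a ring identity to the
-- wanted expression; a contradiction is a certificate for -1.
by : ∀ {x y} → x ≡ y → 0ℤ ≤ x → 0ℤ ≤ y
by = subst (0ℤ ≤_)

0≰-1 : ∀ {X : Set} → 0ℤ ≤ -1ℤ → X
0≰-1 ()

0≤sq : ∀ x → 0ℤ ≤ x * x
0≤sq (+ m)    = 0≤+ m ⊗ 0≤+ m
0≤sq -[1+ m ] = +≤+ z≤n

sq≡0 : ∀ x → x * x ≡ 0ℤ → x ≡ 0ℤ
sq≡0 x e with ℤₚ.i*j≡0⇒i≡0∨j≡0 x e
... | inj₁ p = p
... | inj₂ p = p

-- Integrality enters here: y (y - 1) is negative only strictly between 0 and 1.
0≤y²-y : ∀ y → 0ℤ ≤ y * y - y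
0≤y²-y (+ zero)  = +≤+ z≤n
0≤y²-y (+ suc m) = by (lem (+ m)) (0≤+ (suc m) ⊗ 0≤+ m)
  where
  lem : ∀ m → (1ℤ + m) * m ≡ (1ℤ + m) * (1ℤ + m) - (1ℤ + m)
  lem = solve-∀
0≤y²-y -[1+ m ]  = +≤+ z≤n

∑-nonneg : ∀ (rs : List A) {f} → (∀ r → 0ℤ ≤ f r) → 0ℤ ≤ ∑ rs f
∑-nonneg []       h = 0≤+ 0
∑-nonneg (r ∷ rs) h = h r ⊕ ∑-nonneg rs h

sum≡0ˡ : ∀ {x y} → 0ℤ ≤ x → 0ℤ ≤ y → x + y ≡ 0ℤ → x ≡ 0ℤ
sum≡0ˡ {x} {y} p q e = ℤₚ.≤-antisym (ℤₚ.0≤i-j⇒j≤i (by (lem x y e) q)) p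
  where
  lem : ∀ x y → x + y ≡ 0ℤ → y ≡ 0ℤ - x
  lem x y e = ≡.trans (l x y) (cong (_- x) e)
    where
    l : ∀ x y → y ≡ x + y - x
    l = solve-∀

sum≡0ʳ : ∀ {x y} → 0ℤ ≤ x → 0ℤ ≤ y → x + y ≡ 0ℤ → y ≡ 0ℤ
sum≡0ʳ {x} {y} p q e = sum≡0ˡ q p (≡.trans (ℤₚ.+-comm y x) e)

∑≡0⇒All≡0 : ∀ (rs : List A) {f} → (∀ r → 0ℤ ≤ f r) → ∑ rs f ≡ 0ℤ → All (λ r → f r ≡ 0ℤ) rs
∑≡0⇒All≡0 []       h e = []
∑≡0⇒All≡0 (r ∷ rs) h e =
  sum≡0ˡ (h r) (∑-nonneg rs h) e ∷ ∑≡0⇒All≡0 rs h (sum≡0ʳ (h r) (∑-nonneg rs h) e)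

-- Linear forms and homogeneous systems

-- The coefficients form an infinite sequence, so that dropping the first unknown is composition
-- with `suc`; the vector alone fixes the number of unknowns.
dot : ∀ {m} → (ℕ → ℤ) → Vec ℤ m → ℤ
dot f []       = 0ℤ
dot f (x ∷ xs) = x * f 0 + dot (f ∘ suc) xs

dot-0 : ∀ f m → dot f (Vec.replicate m 0ℤ) ≡ 0ℤ
dot-0 f zero    = refl
dot-0 f (suc m) = ≡.trans (ℤₚ.+-identityˡ _) (dot-0 (f ∘ suc) m)

dot-scale : ∀ {m} f c (xs : Vec ℤ m) → dot f (Vec.map (c *_) xs) ≡ c * dot f xs
dot-scale f c []       = sym (ℤₚ.*-zeroʳ c)
dot-scale f c (x ∷ xs) = ≡.trans (cong (_+_ (c * x * f 0)) (dot-scale (f ∘ suc) c xs)) (lem c x (f 0) _)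
  where
  lem : ∀ c x y d → c * x * y + c * d ≡ c * (x * y + d)
  lem = solve-∀

dot-comb : ∀ {m} f g c d (xs : Vec ℤ m) → dot (λ i → c * f i - d * g i) xs ≡ c * dot f xs - d * dot g xs
dot-comb f g c d []       = lem c d
  where
  lem : ∀ c d → 0ℤ ≡ c * 0ℤ - d * 0ℤ
  lem = solve-∀
dot-comb f g c d (x ∷ xs) =
  ≡.trans (cong (_+_ (x * (c * f 0 - d * g 0))) (dot-comb (f ∘ suc) (g ∘ suc) c d xs)) (lem c d x (f 0) (g 0) _ _)
  where
  lem : ∀ c d x f g F G → x * (c * f - d * g) + (c * F - d * G) ≡ c * (x * f + F) - d * (x * g + G)
  lem = solve-∀

AllZero : ∀ {m} → Vec ℤ m → Set
AllZero = VAll.All (_≡ 0ℤ)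

pivot : (rows : List (ℕ → ℤ)) →
  All (λ f → f 0 ≡ 0ℤ) rows ⊎ (∃₂ λ r rest → (rows ↭ r ∷ rest) × r 0 ≢ 0ℤ)
pivot []         = inj₁ []
pivot (f ∷ rows) with f 0 ℤₚ.≟ 0ℤ
... | no f≢0  = inj₂ (f , rows , ↭-refl , f≢0)
... | yes f≡0 with pivot rows
...   | inj₁ all≡0              = inj₁ (f≡0 ∷ all≡0)
...   | inj₂ (r , rest , p , r≢0) = inj₂ (r , f ∷ rest , trans (prep f p) (swap f r ↭-refl) , r≢0)

scale-zero : ∀ {m} c (xs : Vec ℤ m) → c ≢ 0ℤ → AllZero (Vec.map (c *_) xs) → AllZero xs
scale-zero c []       c≢0 _ = VAll.[]
scale-zero c (x ∷ xs) c≢0 (e VAll.∷ es) with ℤₚ.i*j≡0⇒i≡0∨j≡0 c e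
... | inj₁ c≡0 = contradiction c≡0 c≢0
... | inj₂ x≡0 = x≡0 VAll.∷ scale-zero c xs c≢0 es

-- Fraction-free Gaussian elimination: cross-multiplying with a pivot row removes one equation and
-- one unknown, so the surplus of unknowns is preserved.
nullVector : ∀ n (rows : List (ℕ → ℤ)) → length rows ℕ.< n →
  Σ (Vec ℤ n) λ x → ¬ AllZero x × All (λ f → dot f x ≡ 0ℤ) rows
nullVector (suc m) rows (s≤s l≤m) with pivot rows
-- No row involves the first unknown, so the first unit vector is a solution.
... | inj₁ all≡0 = 1ℤ ∷ Vec.replicate m 0ℤ , (λ { (() VAll.∷ _) }) , All.map (λ {f} → ok f) all≡0
  where
  ok : ∀ f → f 0 ≡ 0ℤ → dot f (1ℤ ∷ Vec.replicate m 0ℤ) ≡ 0ℤ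
  ok f e = cong₂ (λ a b → 1ℤ * a + b) e (dot-0 (f ∘ suc) m)
... | inj₂ (r , rest , p , r≢0) with nullVector m (map elim rest) shorter
  where
  elim : (ℕ → ℤ) → ℕ → ℤ
  elim f i = r 0 * f (suc i) - f 0 * r (suc i)
  shorter : length (map elim rest) ℕ.< m
  shorter = subst (ℕ._≤ m) (≡.trans (↭-length p) (cong suc (sym (Listₚ.length-map elim rest)))) l≤m
... | y , y≢0 , sol =
  x , (λ { (_ VAll.∷ z) → y≢0 (scale-zero (r 0) y r≢0 z) }) ,
  All-resp-↭ (↭-sym p) (solR ∷ All.map (λ {f} → ok f) (Allₚ.map⁻ sol))
  where
  -- Back substitution: once the other entries are multiplied by the pivot, the pivot equation is
  -- solved by an integral first entry.
  x : Vec ℤ (suc m)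
  x = - dot (r ∘ suc) y ∷ Vec.map (r 0 *_) y
  solR : dot r x ≡ 0ℤ
  solR = ≡.trans (cong (_+_ (- dot (r ∘ suc) y * r 0)) (dot-scale (r ∘ suc) (r 0) y)) (lem (r 0) (dot (r ∘ suc) y))
    where
    lem : ∀ c d → - d * c + c * d ≡ 0ℤ
    lem = solve-∀
  ok : ∀ f → dot (λ i → r 0 * f (suc i) - f 0 * r (suc i)) y ≡ 0ℤ → dot f x ≡ 0ℤ
  ok f e = begin
    - dot (r ∘ suc) y * f 0 + dot (f ∘ suc) (Vec.map (r 0 *_) y)
      ≡⟨ cong (_+_ (- dot (r ∘ suc) y * f 0)) (dot-scale (f ∘ suc) (r 0) y) ⟩
    - dot (r ∘ suc) y * f 0 + r 0 * dot (f ∘ suc) y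
      ≡⟨ lem (r 0) (f 0) _ _ ⟩
    r 0 * dot (f ∘ suc) y - f 0 * dot (r ∘ suc) y
      ≡⟨ dot-comb (f ∘ suc) (r ∘ suc) (r 0) (f 0) y ⟨
    dot (λ i → r 0 * f (suc i) - f 0 * r (suc i)) y
      ≡⟨ e ⟩
    0ℤ ∎
    where
    open ≡-Reasoning
    lem : ∀ c f d e → - d * f + c * e ≡ c * e - f * d
    lem = solve-∀

-- Bits with a path-invariant Gram matrix

Bit : ℤ → Set
Bit x = x ≡ 0ℤ ⊎ x ≡ 1ℤ

sumᵥ : ∀ {m} → Vec ℤ m → ℤ
sumᵥ []       = 0ℤ
sumᵥ (x ∷ xs) = x + sumᵥ xs

squares : ∀ {m} → Vec ℤ m → ℤ
squares []       = 0ℤ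
squares (x ∷ xs) = x * x + squares xs

-- The extra argument is the entry preceding the vector; with 0 in its place the result is x₀ x₁ +
-- x₁ x₂ + ....
consecutive : ∀ {m} → ℤ → Vec ℤ m → ℤ
consecutive x []       = 0ℤ
consecutive x (y ∷ ys) = x * y + consecutive y ys

-- The Gram matrix of the first m columns of `u` is B J + b I - c P, where J is the all-ones matrix
-- and P the adjacency matrix of a path. The indices in `far` run over all pairs at distance at
-- least two.
record PathGram (rows : List A) (u : A → ℕ → ℤ) (B b c : ℤ) (m : ℕ) : Set where
  field
    diag : ∀ i → i ℕ.< m → ∑ rows (λ r → u r i * u r i) ≡ B + b
    adj  : ∀ i → suc i ℕ.< m → ∑ rows (λ r → u r i * u r (suc i)) ≡ B - c
    far  : ∀ i j → 2 ℕ.+ i ℕ.+ j ℕ.< m → ∑ rows (λ r → u r i * u r (2 ℕ.+ i ℕ.+ j)) ≡ B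

-- Serves for column sums, with `f` constantly 1, and for the products of the first column with the
-- columns at distance at least two.
∑-dot : ∀ (rows : List A) (f : A → ℤ) (w : A → ℕ → ℤ) g {l} → (∀ j → j ℕ.< l → ∑ rows (λ r → f r * w r j) ≡ g) →
  ∀ {m} → m ℕ.≤ l → (xs : Vec ℤ m) → ∑ rows (λ r → f r * dot (w r) xs) ≡ g * sumᵥ xs
∑-dot rows f w g h _ [] =
  ≡.trans (∑-0 rows (All.universal (λ r → ℤₚ.*-zeroʳ (f r)) rows)) (sym (ℤₚ.*-zeroʳ g))
∑-dot rows f w g h (s≤s le) (x ∷ xs) = begin
  ∑ rows (λ r → f r * (x * w r 0 + dot (w r ∘ suc) xs))
    ≡⟨ ∑-cong rows (λ r → lem (f r) x (w r 0) _) ⟩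
  ∑ rows (λ r → x * (f r * w r 0) + f r * dot (w r ∘ suc) xs)
    ≡⟨ ∑-+ rows _ _ ⟩
  ∑ rows (λ r → x * (f r * w r 0)) + ∑ rows (λ r → f r * dot (w r ∘ suc) xs)
    ≡⟨ cong₂ _+_ (≡.trans (∑-* rows x _) (cong (x *_) (h 0 (s≤s z≤n))))
                 (∑-dot rows f (λ r → w r ∘ suc) g (λ j j<l → h (suc j) (s≤s j<l)) le xs) ⟩
  x * g + g * sumᵥ xs
    ≡⟨ lem₂ x g _ ⟩
  g * (x + sumᵥ xs) ∎
  where
  open ≡-Reasoning
  lem : ∀ f x w d → f * (x * w + d) ≡ x * (f * w) + f * d
  lem = solve-∀
  lem₂ : ∀ x g s → x * g + g * s ≡ g * (x + s)
  lem₂ = solve-∀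

module _ {rows : List A} {B b c : ℤ} where

  shift : ∀ {u m} → PathGram rows u B b c (suc m) → PathGram rows (λ r → u r ∘ suc) B b c m
  shift G = record
    { diag = λ i i<m → diag (suc i) (s≤s i<m)
    ; adj  = λ i i<m → adj (suc i) (s≤s i<m)
    ; far  = λ i j i<m → far (suc i) j (s≤s i<m)
    } where open PathGram G

  -- The difference `consecutive x xs - consecutive 0ℤ xs` is x times the first entry of `xs`, or 0
  -- if there is none; writing it so avoids a case distinction.
  cross : ∀ {u l} → PathGram rows u B b c (suc l) → ∀ {m} → m ℕ.≤ l → ∀ (x : ℤ) (xs : Vec ℤ m) →
    x * ∑ rows (λ r → u r 0 * dot (u r ∘ suc) xs) ≡ x * (B * sumᵥ xs) - c * consecutive x xs + c * consecutive 0ℤ xs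
  cross {u} G _ x [] = ≡.trans (cong (x *_) (∑-0 rows (All.universal (λ r → ℤₚ.*-zeroʳ (u r 0)) rows))) (lem x B c)
    where
    lem : ∀ x B c → x * 0ℤ ≡ x * (B * 0ℤ) - c * 0ℤ + c * 0ℤ
    lem = solve-∀
  cross {u} G (s≤s le) x (y ∷ ys) = begin
    x * ∑ rows (λ r → u r 0 * (y * u r 1 + dot (λ i → u r (2 ℕ.+ i)) ys))
      ≡⟨ cong (x *_) (∑-cong rows (λ r → lem (u r 0) y (u r 1) _)) ⟩
    x * ∑ rows (λ r → y * (u r 0 * u r 1) + u r 0 * dot (λ i → u r (2 ℕ.+ i)) ys)
      ≡⟨ cong (x *_) (∑-+ rows _ _) ⟩
    x * (∑ rows (λ r → y * (u r 0 * u r 1)) + ∑ rows (λ r → u r 0 * dot (λ i → u r (2 ℕ.+ i)) ys))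
      ≡⟨ cong (x *_) (cong₂ _+_ (≡.trans (∑-* rows y _) (cong (y *_) (adj 0 (s≤s (s≤s z≤n)))))
           (∑-dot rows (λ r → u r 0) (λ r i → u r (2 ℕ.+ i)) B (λ j j<l → far 0 j (s≤s (s≤s j<l))) le ys)) ⟩
    x * (y * (B - c) + B * sumᵥ ys)
      ≡⟨ lem₂ x y B c (sumᵥ ys) (consecutive y ys) ⟩
    x * (B * (y + sumᵥ ys)) - c * (x * y + consecutive y ys) + c * (0ℤ * y + consecutive y ys) ∎
    where
    open ≡-Reasoning
    open PathGram G
    lem : ∀ f x w d → f * (x * w + d) ≡ x * (f * w) + f * d
    lem = solve-∀
    lem₂ : ∀ x y B c s k → x * (y * (B - c) + B * s) ≡ x * (B * (y + s)) - c * (x * y + k) + c * (0ℤ * y + k)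
    lem₂ = solve-∀

  -- The square is expanded with the first coordinate split off: its square is governed by `diag`,
  -- its products with the rest by `cross`, and the rest by induction on the shifted columns.
  quadraticForm : ∀ {u l} → PathGram rows u B b c l → ∀ {m} → m ℕ.≤ l → (xs : Vec ℤ m) →
    ∑ rows (λ r → dot (u r) xs * dot (u r) xs) ≡
      B * (sumᵥ xs * sumᵥ xs) + b * squares xs - + 2 * c * consecutive 0ℤ xs
  quadraticForm G _ [] = ≡.trans (∑-0 rows (All.universal (λ _ → refl) rows)) (lem B b c)
    where
    lem : ∀ B b c → 0ℤ ≡ B * (0ℤ * 0ℤ) + b * 0ℤ - + 2 * c * 0ℤ
    lem = solve-∀
  quadraticForm {u} G (s≤s le) (x ∷ xs) = begin
    ∑ rows (λ r → (x * u r 0 + D r) * (x * u r 0 + D r))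
      ≡⟨ ∑-cong rows (λ r → lem x (u r 0) (D r)) ⟩
    ∑ rows (λ r → x * x * (u r 0 * u r 0) + (+ 2 * x * (u r 0 * D r) + D r * D r))
      ≡⟨ ≡.trans (∑-+ rows _ _) (cong (_+_ (∑ rows (λ r → x * x * (u r 0 * u r 0)))) (∑-+ rows _ _)) ⟩
    ∑ rows (λ r → x * x * (u r 0 * u r 0)) + (∑ rows (λ r → + 2 * x * (u r 0 * D r)) + ∑ rows (λ r → D r * D r))
      ≡⟨ cong₂ _+_ (≡.trans (∑-* rows (x * x) _) (cong (x * x *_) (diag 0 (s≤s z≤n))))
           (cong₂ _+_ (≡.trans (∑-* rows (+ 2 * x) _)
                        (≡.trans (ℤₚ.*-assoc (+ 2) x _) (cong (+ 2 *_) (cross G le x xs))))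
                      (quadraticForm (shift G) le xs)) ⟩
    x * x * (B + b) + (+ 2 * (x * (B * sumᵥ xs) - c * consecutive x xs + c * consecutive 0ℤ xs)
      + (B * (sumᵥ xs * sumᵥ xs) + b * squares xs - + 2 * c * consecutive 0ℤ xs))
      ≡⟨ lem₂ x B b c (sumᵥ xs) (squares xs) (consecutive x xs) (consecutive 0ℤ xs) ⟩
    B * ((x + sumᵥ xs) * (x + sumᵥ xs)) + b * (x * x + squares xs) - + 2 * c * (0ℤ * x + consecutive x xs) ∎
    where
    open ≡-Reasoning
    open PathGram G
    D : A → ℤ
    D r = dot (u r ∘ suc) xs
    lem : ∀ x u d → (x * u + d) * (x * u + d) ≡ x * x * (u * u) + (+ 2 * x * (u * d) + d * d)
    lem = solve-∀
    lem₂ : ∀ x B b c s q k z →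
      x * x * (B + b) + (+ 2 * (x * (B * s) - c * k + c * z) + (B * (s * s) + b * q - + 2 * c * z)) ≡
      B * ((x + s) * (x + s)) + b * (x * x + q) - + 2 * c * (0ℤ * x + k)
    lem₂ = solve-∀

-- Inequalities for bits and for the path form.

Bit-idem : ∀ {x} → Bit x → x * x ≡ x
Bit-idem (inj₁ refl) = refl
Bit-idem (inj₂ refl) = refl

-- (y - x)(y - z) ≥ 0: the triangle inequality for Hamming distance.
Bit-triangle : ∀ {x y z} → Bit x → Bit y → Bit z → 0ℤ ≤ (y * y - x * y) - (y * z - x * z)
Bit-triangle (inj₁ refl) (inj₁ refl) (inj₁ refl) = 0≤+ _
Bit-triangle (inj₁ refl) (inj₁ refl) (inj₂ refl) = 0≤+ _
Bit-triangle (inj₁ refl) (inj₂ refl) (inj₁ refl) = 0≤+ _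
Bit-triangle (inj₁ refl) (inj₂ refl) (inj₂ refl) = 0≤+ _
Bit-triangle (inj₂ refl) (inj₁ refl) (inj₁ refl) = 0≤+ _
Bit-triangle (inj₂ refl) (inj₁ refl) (inj₂ refl) = 0≤+ _
Bit-triangle (inj₂ refl) (inj₂ refl) (inj₁ refl) = 0≤+ _
Bit-triangle (inj₂ refl) (inj₂ refl) (inj₂ refl) = 0≤+ _

-- Three bits differ in at most two of the three pairs.
Bit-perimeter : ∀ {x y z} → Bit x → Bit y → Bit z →
  0ℤ ≤ 1ℤ - ((x * x - x * y) + ((y * y - y * z) + (z * z - x * z)))
Bit-perimeter (inj₁ refl) (inj₁ refl) (inj₁ refl) = 0≤+ _
Bit-perimeter (inj₁ refl) (inj₁ refl) (inj₂ refl) = 0≤+ _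
Bit-perimeter (inj₁ refl) (inj₂ refl) (inj₁ refl) = 0≤+ _
Bit-perimeter (inj₁ refl) (inj₂ refl) (inj₂ refl) = 0≤+ _
Bit-perimeter (inj₂ refl) (inj₁ refl) (inj₁ refl) = 0≤+ _
Bit-perimeter (inj₂ refl) (inj₁ refl) (inj₂ refl) = 0≤+ _
Bit-perimeter (inj₂ refl) (inj₂ refl) (inj₁ refl) = 0≤+ _
Bit-perimeter (inj₂ refl) (inj₂ refl) (inj₂ refl) = 0≤+ _

Bit-product : ∀ {x y} → Bit x → Bit y → 0ℤ ≤ x * y
Bit-product (inj₁ refl) _           = 0≤+ _
Bit-product (inj₂ refl) (inj₁ refl) = 0≤+ _
Bit-product (inj₂ refl) (inj₂ refl) = 0≤+ _

-- Twice b x² + 2 b Σ xᵢ² - 4 c (x x₀ + x₀ x₁ + …), written as a sum of squares.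
energy : ∀ {m} → ℤ → ℤ → ℤ → Vec ℤ m → ℤ
energy b c x []       = + 2 * b * (x * x)
energy b c x (y ∷ ys) =
  ((b + + 2 * c) * ((x - y) * (x - y)) + (b - + 2 * c) * ((x + y) * (x + y))) + energy b c y ys

-- A link contributes 2 b (x² + y²) - 8 c x y. Every entry after the first thus collects 4 b from
-- its two links, the last one from its link and the closing term.
energy-expand : ∀ {m} b c x (ys : Vec ℤ m) →
  energy b c x ys ≡ + 2 * (b * (x * x) + + 2 * (b * squares ys - + 2 * c * consecutive x ys))
energy-expand b c x []       = lem b c x
  where
  lem : ∀ b c x → + 2 * b * (x * x) ≡ + 2 * (b * (x * x) + + 2 * (b * 0ℤ - + 2 * c * 0ℤ))
  lem = solve-∀
energy-expand b c x (y ∷ ys) =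
  ≡.trans (cong (_+_ ((b + + 2 * c) * ((x - y) * (x - y)) + (b - + 2 * c) * ((x + y) * (x + y))))
                (energy-expand b c y ys))
          (lem b c x y (squares ys) (consecutive y ys))
  where
  lem : ∀ b c x y q k →
    ((b + + 2 * c) * ((x - y) * (x - y)) + (b - + 2 * c) * ((x + y) * (x + y))) +
      + 2 * (b * (y * y) + + 2 * (b * q - + 2 * c * k)) ≡
    + 2 * (b * (x * x) + + 2 * (b * (y * y + q) - + 2 * c * (x * y + k)))
  lem = solve-∀

module _ {b c} (1≤b : 0ℤ ≤ b - 1ℤ) (lo : 0ℤ ≤ b + + 2 * c) (hi : 0ℤ ≤ b - + 2 * c) where

  private
    0≤b : 0ℤ ≤ b
    0≤b = by (lem b) (1≤b ⊕ 0≤+ 1)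
      where
      lem : ∀ b → b - 1ℤ + 1ℤ ≡ b
      lem = solve-∀

  link-nonneg : ∀ x y → 0ℤ ≤ (b + + 2 * c) * ((x - y) * (x - y)) + (b - + 2 * c) * ((x + y) * (x + y))
  link-nonneg x y = lo ⊗ 0≤sq (x - y) ⊕ hi ⊗ 0≤sq (x + y)

  energy-nonneg : ∀ {m} x (ys : Vec ℤ m) → 0ℤ ≤ energy b c x ys
  energy-nonneg x []       = 0≤+ 2 ⊗ 0≤b ⊗ 0≤sq x
  energy-nonneg x (y ∷ ys) = link-nonneg x y ⊕ energy-nonneg y ys

  -- After an entry 0 the next link equals 2 b y², so y vanishes as well, and the zero propagates
  -- along the path.
  energy-definite : ∀ {m} (ys : Vec ℤ m) → energy b c 0ℤ ys ≡ 0ℤ → AllZero ys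
  energy-definite []       e = VAll.[]
  energy-definite (y ∷ ys) e with sq≡0 y y²≡0
    where
    lem : ∀ b c y → (b + + 2 * c) * ((0ℤ - y) * (0ℤ - y)) + (b - + 2 * c) * ((0ℤ + y) * (0ℤ + y)) ≡
      + 2 * (y * y) + + 2 * ((b - 1ℤ) * (y * y))
    lem = solve-∀
    first : + 2 * (y * y) + + 2 * ((b - 1ℤ) * (y * y)) ≡ 0ℤ
    first = ≡.trans (sym (lem b c y)) (sum≡0ˡ (link-nonneg 0ℤ y) (energy-nonneg y ys) e)
    y²≡0 : y * y ≡ 0ℤ
    y²≡0 = ℤₚ.*-cancelˡ-≡ (+ 2) (y * y) 0ℤ (sum≡0ˡ (0≤+ 2 ⊗ 0≤sq y) (0≤+ 2 ⊗ (1≤b ⊗ 0≤sq y)) first)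
  ... | refl = refl VAll.∷ energy-definite ys (sum≡0ʳ (link-nonneg 0ℤ 0ℤ) (energy-nonneg 0ℤ ys) e)

positive-or-nonpositive : ∀ x → 0ℤ ≤ x - 1ℤ ⊎ 0ℤ ≤ - x
positive-or-nonpositive (+ zero)  = inj₂ (0≤+ 0)
positive-or-nonpositive (+ suc m) = inj₁ (by (lem (+ m)) (0≤+ m))
  where
  lem : ∀ m → m ≡ 1ℤ + m - 1ℤ
  lem = solve-∀
positive-or-nonpositive -[1+ m ]  = inj₂ (0≤+ _)

-- The test vector of the hypermetric inequality.

module Ramp (r : ℕ) where

  -- Preceded by a 1 and taken at s = r, this is (1^{r+1}, 0, (-1)^r). The number s of ones is kept
  -- separate from r to allow induction on it.
  tail : ∀ s → Vec ℤ (s ℕ.+ suc r)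
  tail s = Vec.replicate s 1ℤ Vec.++ (0ℤ ∷ Vec.replicate r -1ℤ)

  sum-minus : ∀ r → sumᵥ (Vec.replicate r -1ℤ) ≡ - + r
  sum-minus zero    = refl
  sum-minus (suc r) = ≡.trans (cong (_+_ -1ℤ) (sum-minus r)) (lem (+ r))
    where
    lem : ∀ r → -1ℤ + - r ≡ - (1ℤ + r)
    lem = solve-∀

  squares-minus : ∀ r → squares (Vec.replicate r -1ℤ) ≡ + r
  squares-minus zero    = refl
  squares-minus (suc r) = cong (_+_ 1ℤ) (squares-minus r)

  consecutive-minus : ∀ r → consecutive -1ℤ (Vec.replicate r -1ℤ) ≡ + r
  consecutive-minus zero    = refl
  consecutive-minus (suc r) = cong (_+_ 1ℤ) (consecutive-minus r)

  sum-tail : ∀ s → sumᵥ (tail s) ≡ + s - + r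
  sum-tail zero    = cong (_+_ 0ℤ) (sum-minus r)
  sum-tail (suc s) = ≡.trans (cong (_+_ 1ℤ) (sum-tail s)) (sym (ℤₚ.+-assoc 1ℤ (+ s) (- + r)))

  squares-tail : ∀ s → squares (tail s) ≡ + s + + r
  squares-tail zero    = cong (_+_ 0ℤ) (squares-minus r)
  squares-tail (suc s) = ≡.trans (cong (_+_ 1ℤ) (squares-tail s)) (sym (ℤₚ.+-assoc 1ℤ (+ s) (+ r)))

  consecutive-tail : ∀ s → consecutive 1ℤ (tail s) ≡ + s + consecutive 0ℤ (Vec.replicate r -1ℤ)
  consecutive-tail zero    = refl
  consecutive-tail (suc s) =
    ≡.trans (cong (_+_ 1ℤ) (consecutive-tail s))
      (sym (ℤₚ.+-assoc 1ℤ (+ s) (consecutive 0ℤ (Vec.replicate r -1ℤ))))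

cong₃ : ∀ {A B C D : Set} (f : A → B → C → D) {a a′ b b′ c c′} → a ≡ a′ → b ≡ b′ → c ≡ c′ → f a b c ≡ f a′ b′ c′
cong₃ f refl refl refl = refl

-- The test vector will have even length 4 + 2 r; this is the longest one that fits into n columns.
half : ∀ n → 4 ℕ.≤ n → ∃ λ r → (4 ℕ.+ (r ℕ.+ r) ℕ.≤ n) × (n ℕ.≤ 5 ℕ.+ (r ℕ.+ r))
half 4 _ = 0 , ℕₚ.≤-refl , ℕₚ.n≤1+n 4
half 5 _ = 0 , ℕₚ.n≤1+n 4 , ℕₚ.≤-refl
half (suc (suc n@(suc (suc (suc (suc _)))))) _ with half n (s≤s (s≤s (s≤s (s≤s z≤n))))
... | r , lo , hi = suc r ,
  subst (ℕ._≤ 2 ℕ.+ n) (cong (5 ℕ.+_) (sym (ℕₚ.+-suc r r))) (s≤s (s≤s lo)) ,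
  subst (2 ℕ.+ n ℕ.≤_) (cong (6 ℕ.+_) (sym (ℕₚ.+-suc r r))) (s≤s (s≤s hi))
half 1 (s≤s ())
half 2 (s≤s (s≤s ()))
half 3 (s≤s (s≤s (s≤s ())))

-- Equality of adjacent columns when there are fewer rows than columns.

module _ {rows : List A} {u : A → ℕ → ℤ} {B b c : ℤ} {n : ℕ}
         (bit : ∀ r i → Bit (u r i)) (G : PathGram rows u B b c n)
         (4≤n : 4 ℕ.≤ n) (p<n : length rows ℕ.< n) where
  open PathGram G

  private
    p : ℤ
    p = + length rows

    below : ∀ {i} → i ℕ.< 4 → i ℕ.< n
    below i<4 = ℕₚ.≤-trans i<4 4≤n

    G₀₁ : ∑ rows (λ r → u r 0 * u r 1) ≡ B - c
    G₀₁ = adj 0 (below (s≤s (s≤s z≤n)))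

    G₁₂ : ∑ rows (λ r → u r 1 * u r 2) ≡ B - c
    G₁₂ = adj 1 (below (s≤s (s≤s (s≤s z≤n))))

    G₀₂ : ∑ rows (λ r → u r 0 * u r 2) ≡ B
    G₀₂ = far 0 0 (below (s≤s (s≤s (s≤s z≤n))))

    Gᵢᵢ : ∀ i → i ℕ.< 4 → ∑ rows (λ r → u r i * u r i) ≡ B + b
    Gᵢᵢ i i<4 = diag i (below i<4)

    triangle : ∀ i j k {yy xy yz xz} → ∑ rows (λ r → u r j * u r j) ≡ yy → ∑ rows (λ r → u r i * u r j) ≡ xy →
      ∑ rows (λ r → u r j * u r k) ≡ yz → ∑ rows (λ r → u r i * u r k) ≡ xz → 0ℤ ≤ (yy - xy) - (yz - xz)
    triangle i j k refl refl refl refl = by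
      (≡.trans (∑-- rows _ _) (cong₂ _-_ (∑-- rows _ _) (∑-- rows _ _)))
      (∑-nonneg rows (λ r → Bit-triangle (bit r i) (bit r j) (bit r k)))

    -- Sums (u₁ - u₀)(u₁ - u₂) over the rows.
    lower : 0ℤ ≤ b + + 2 * c
    lower = by (lem B b c) (triangle 0 1 2 (Gᵢᵢ 1 (s≤s (s≤s z≤n))) G₀₁ G₁₂ G₀₂)
      where
      lem : ∀ B b c → (B + b - (B - c)) - (B - c - B) ≡ b + + 2 * c
      lem = solve-∀

    -- Sums (u₃ - u₀)(u₃ - u₁), where column 3 is adjacent to neither of the adjacent columns 0 and
    -- 1.
    c≤b : 0ℤ ≤ b - c
    c≤b = by (lem B b c) (triangle 0 3 1 (Gᵢᵢ 3 (s≤s (s≤s (s≤s (s≤s z≤n)))))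
      (far 0 1 4≤n) (≡.trans (∑-cong rows (λ r → ℤₚ.*-comm (u r 3) (u r 1))) (far 1 0 4≤n)) G₀₁)
      where
      lem : ∀ B b c → (B + b - B) - (B - (B - c)) ≡ b - c
      lem = solve-∀

    -- Columns 0, 1, 2 have halved pairwise Hamming distances b + c, b + c and b, and each row
    -- contributes at most 1 to their sum.
    perimeter : 0ℤ ≤ p - (+ 3 * b + + 2 * c)
    perimeter = by (≡.trans eq (lem p B b c))
      (∑-nonneg rows (λ r → Bit-perimeter (bit r 0) (bit r 1) (bit r 2)))
      where
      lem : ∀ p B b c → p - ((B + b - (B - c)) + ((B + b - (B - c)) + (B + b - B))) ≡ p - (+ 3 * b + + 2 * c)
      lem = solve-∀
      eq : _ ≡ p - ((B + b - (B - c)) + ((B + b - (B - c)) + (B + b - B)))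
      eq = ≡.trans (∑-- rows _ _) (cong₂ _-_ (∑-1 rows)
        (≡.trans (∑-+ rows _ _) (cong₂ _+_
          (≡.trans (∑-- rows _ _) (cong₂ _-_ (Gᵢᵢ 0 (s≤s z≤n)) G₀₁))
          (≡.trans (∑-+ rows _ _) (cong₂ _+_
            (≡.trans (∑-- rows _ _) (cong₂ _-_ (Gᵢᵢ 1 (s≤s (s≤s z≤n))) G₁₂))
            (≡.trans (∑-- rows _ _) (cong₂ _-_ (Gᵢᵢ 2 (s≤s (s≤s (s≤s z≤n)))) G₀₂)))))))

    -- Bits are idempotent, so every column sum is the diagonal Gram entry B + b.
    ∑-dot-rows : ∀ {m} → m ℕ.≤ n → (x : Vec ℤ m) → ∑ rows (λ r → dot (u r) x) ≡ (B + b) * sumᵥ x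
    ∑-dot-rows m≤n x = ≡.trans (∑-cong rows (λ r → sym (ℤₚ.*-identityˡ _)))
      (∑-dot rows (λ _ → 1ℤ) u (B + b)
        (λ j j<n → ≡.trans (∑-cong rows (λ r → ≡.trans (ℤₚ.*-identityˡ _) (sym (Bit-idem (bit r j))))) (diag j j<n))
        m≤n x)

    module _ (1≤a : 0ℤ ≤ b + c - 1ℤ) where

      -- As c ≤ b, having b ≤ 0 would force b + c ≤ 0.
      1≤b : 0ℤ ≤ b - 1ℤ
      1≤b with positive-or-nonpositive b
      ... | inj₁ h = h
      ... | inj₂ h = 0≰-1 (by (lem b c) (0≤+ 2 ⊗ h ⊕ c≤b ⊕ 1≤a))
        where
        lem : ∀ b c → + 2 * - b + (b - c) + (b + c - 1ℤ) ≡ -1ℤ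
        lem = solve-∀

      -- A null vector of the rows is orthogonal to the all-ones vector, and on that
      -- hyperplane the quadratic form is positive definite as soon as 2 ∣c∣ ≤ b.
      definite-case : 0ℤ ≤ - (+ 2 * c - b) → ⊥
      definite-case hi with nullVector n (map u rows) (subst (ℕ._< n) (sym (Listₚ.length-map u rows)) p<n)
      ... | x , x≢0 , null = x≢0 (energy-definite 1≤b lower hi′ x energy≡0)
        where
        hi′ : 0ℤ ≤ b - + 2 * c
        hi′ = by (lem b c) hi
          where
          lem : ∀ b c → - (+ 2 * c - b) ≡ b - + 2 * c
          lem = solve-∀
        null′ : All (λ r → dot (u r) x ≡ 0ℤ) rows
        null′ = Allₚ.map⁻ null
        -- The column sum is (B - c) + (b + c), with B - c ≥ 0 as a sum of products of bits and b +
        -- c ≥ 1.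
        N≢0 : B + b ≢ 0ℤ
        N≢0 N≡0 = 0≰-1 (by (≡.trans (lem B b c) (cong (_- 1ℤ) N≡0)) (0≤A ⊕ 1≤a))
          where
          0≤A : 0ℤ ≤ B - c
          0≤A = by G₀₁ (∑-nonneg rows (λ r → Bit-product (bit r 0) (bit r 1)))
          lem : ∀ B b c → B - c + (b + c - 1ℤ) ≡ B + b - 1ℤ
          lem = solve-∀
        sum≡0 : sumᵥ x ≡ 0ℤ
        sum≡0 with ℤₚ.i*j≡0⇒i≡0∨j≡0 (B + b) (≡.trans (sym (∑-dot-rows ℕₚ.≤-refl x)) (∑-0 rows null′))
        ... | inj₁ N≡0 = contradiction N≡0 N≢0
        ... | inj₂ s≡0 = s≡0
        form≡0 : b * squares x - + 2 * c * consecutive 0ℤ x ≡ 0ℤ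
        form≡0 = begin
          b * squares x - + 2 * c * consecutive 0ℤ x
            ≡⟨ lem B b c _ _ ⟩
          B * (0ℤ * 0ℤ) + b * squares x - + 2 * c * consecutive 0ℤ x
            ≡⟨ cong (λ s → B * (s * s) + b * squares x - + 2 * c * consecutive 0ℤ x) sum≡0 ⟨
          B * (sumᵥ x * sumᵥ x) + b * squares x - + 2 * c * consecutive 0ℤ x
            ≡⟨ quadraticForm G ℕₚ.≤-refl x ⟨
          ∑ rows (λ r → dot (u r) x * dot (u r) x)
            ≡⟨ ∑-0 rows (All.map (λ e → cong₂ _*_ e e) null′) ⟩
          0ℤ ∎
          where
          open ≡-Reasoning
          lem : ∀ B b c q k → b * q - + 2 * c * k ≡ B * (0ℤ * 0ℤ) + b * q - + 2 * c * k
          lem = solve-∀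
        -- With leading argument 0 the energy is four times the form.
        energy≡0 : energy b c 0ℤ x ≡ 0ℤ
        energy≡0 = ≡.trans (energy-expand b c 0ℤ x)
          (≡.trans (cong (λ f → + 2 * (b * (0ℤ * 0ℤ) + + 2 * f)) form≡0) (lem b))
          where
          lem : ∀ b → + 2 * (b * (0ℤ * 0ℤ) + + 2 * 0ℤ) ≡ 0ℤ
          lem = solve-∀

      -- With r = R + 1 and y = u₀ + … + u_r - (u_{r+2} + … + u_{2r+1}), summing the
      -- integer inequality y (y - 1) ≥ 0 over the rows gives c (2 r - 1) ≤ b r.
      hypermetric-case : 0ℤ ≤ + 2 * c - b - 1ℤ → ⊥
      hypermetric-case hi with half n 4≤n
      -- From 2 c ≥ b + 1 follows p ≥ 3 b + 2 c ≥ 4 b + 1; with b ≥ 2 R + 1 and b ≥ 1 this gives p ≥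
      -- 2 R + 5, whereas p < n ≤ 2 R + 5.
      ... | R , lo , n≤ = 0≰-1 (by (lem₃ b c p (+ R)) (hyper′ ⊕ perimeter ⊕ hi ⊕ bound ⊕ 0≤+ 3 ⊗ 1≤b))
        where
        open Ramp (suc R)
        x : Vec ℤ (suc (suc R ℕ.+ suc (suc R)))
        x = 1ℤ ∷ tail (suc R)
        fits : suc (suc R ℕ.+ suc (suc R)) ℕ.≤ n
        fits = subst (ℕ._≤ n) (cong (2 ℕ.+_) (sym (≡.trans (ℕₚ.+-suc R (suc R)) (cong suc (ℕₚ.+-suc R R))))) lo
        -- The entries of `x` sum to 1, so the B of the quadratic form cancels against that of the
        -- column sum.
        hyper : 0ℤ ≤ b * (+ 2 + + 2 * + R) - + 2 * c * (1ℤ + + 2 * + R)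
        hyper = by (≡.trans eq (lem B b c (+ R))) (∑-nonneg rows (λ r → 0≤y²-y (dot (u r) x)))
          where
          lem : ∀ B b c R →
            B * ((1ℤ + (1ℤ + R - (1ℤ + R))) * (1ℤ + (1ℤ + R - (1ℤ + R)))) + b * (1ℤ + (1ℤ + R + (1ℤ + R)))
              - + 2 * c * (0ℤ + (1ℤ + R + (0ℤ + R))) - (B + b) * (1ℤ + (1ℤ + R - (1ℤ + R)))
              ≡ b * (+ 2 + + 2 * R) - + 2 * c * (1ℤ + + 2 * R)
          lem = solve-∀
          eq : ∑ rows (λ r → dot (u r) x * dot (u r) x - dot (u r) x) ≡
            B * ((1ℤ + (1ℤ + + R - (1ℤ + + R))) * (1ℤ + (1ℤ + + R - (1ℤ + + R)))) + b * (1ℤ + (1ℤ + + R + (1ℤ + + R)))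
              - + 2 * c * (0ℤ + (1ℤ + + R + (0ℤ + + R))) - (B + b) * (1ℤ + (1ℤ + + R - (1ℤ + + R)))
          eq = ≡.trans (∑-- rows _ _) (≡.trans
            (cong₂ _-_ (quadraticForm G fits x) (∑-dot-rows fits x))
            (cong₃ (λ s q k → B * ((1ℤ + s) * (1ℤ + s)) + b * (1ℤ + q) - + 2 * c * (0ℤ + k) - (B + b) * (1ℤ + s))
              (sum-tail (suc R)) (squares-tail (suc R))
              (≡.trans (consecutive-tail (suc R)) (cong (λ t → + suc R + (0ℤ + t)) (consecutive-minus R)))))
        -- Replaces 2 c by its lower bound b + 1, which leaves a bound on b alone.
        hyper′ : 0ℤ ≤ b - (1ℤ + + 2 * + R)
        hyper′ = by (lem b c (+ R)) (hyper ⊕ hi ⊗ (0≤+ 1 ⊕ 0≤+ 2 ⊗ 0≤+ R))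
          where
          lem : ∀ b c R → b * (+ 2 + + 2 * R) - + 2 * c * (1ℤ + + 2 * R) + (+ 2 * c - b - 1ℤ) * (1ℤ + + 2 * R)
            ≡ b - (1ℤ + + 2 * R)
          lem = solve-∀
        bound : 0ℤ ≤ + 4 + (+ R + + R) - p
        bound = ℤₚ.i≤j⇒0≤j-i (+≤+ (ℕₚ.≤-pred (ℕₚ.≤-trans p<n n≤)))
        lem₃ : ∀ b c p R → b - (1ℤ + + 2 * R) + (p - (+ 3 * b + + 2 * c)) + (+ 2 * c - b - 1ℤ) + (+ 4 + (R + R) - p)
          + + 3 * (b - 1ℤ) ≡ -1ℤ
        lem₃ = solve-∀

      absurd : ⊥
      absurd with positive-or-nonpositive (+ 2 * c - b)
      ... | inj₁ h = hypermetric-case h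
      ... | inj₂ h = definite-case h

  -- The squared differences of two adjacent columns add up to 2 (b + c), so they all vanish once b
  -- + c ≥ 1 is excluded.
  adjacent-equal : ∀ i → suc i ℕ.< n → All (λ r → u r i ≡ u r (suc i)) rows
  adjacent-equal i i+1<n with positive-or-nonpositive (b + c)
  ... | inj₁ 1≤a = ⊥-elim (absurd 1≤a)
  ... | inj₂ a≤0 = All.map (λ e → ℤₚ.i-j≡0⇒i≡j _ _ (sq≡0 _ e))
    (∑≡0⇒All≡0 rows sq≥0 (ℤₚ.≤-antisym
      (ℤₚ.0≤i-j⇒j≤i (by (≡.trans (lem₂ b c) (cong (λ t → 0ℤ - t) (sym total))) (0≤+ 2 ⊗ a≤0)))
      (∑-nonneg rows sq≥0)))
    where
    sq≥0 : ∀ r → 0ℤ ≤ (u r i - u r (suc i)) * (u r i - u r (suc i))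
    sq≥0 r = 0≤sq (u r i - u r (suc i))
    lem : ∀ x y → (x - y) * (x - y) ≡ x * x + y * y - + 2 * (x * y)
    lem = solve-∀
    lem₁ : ∀ B b c → B + b + (B + b) - + 2 * (B - c) ≡ + 2 * (b + c)
    lem₁ = solve-∀
    lem₂ : ∀ b c → + 2 * - (b + c) ≡ 0ℤ - + 2 * (b + c)
    lem₂ = solve-∀
    total : ∑ rows (λ r → (u r i - u r (suc i)) * (u r i - u r (suc i))) ≡ + 2 * (b + c)
    total = begin
      ∑ rows (λ r → (u r i - u r (suc i)) * (u r i - u r (suc i)))
        ≡⟨ ∑-cong rows (λ r → lem (u r i) (u r (suc i))) ⟩
      ∑ rows (λ r → u r i * u r i + u r (suc i) * u r (suc i) - + 2 * (u r i * u r (suc i)))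
        ≡⟨ ≡.trans (∑-- rows _ _) (cong₂ _-_ (∑-+ rows _ _) (∑-* rows (+ 2) _)) ⟩
      ∑ rows (λ r → u r i * u r i) + ∑ rows (λ r → u r (suc i) * u r (suc i))
        - + 2 * ∑ rows (λ r → u r i * u r (suc i))
        ≡⟨ cong₂ _-_ (cong₂ _+_ (diag i (ℕₚ.<-trans (ℕₚ.n<1+n i) i+1<n)) (diag (suc i) i+1<n))
                     (cong (+ 2 *_) (adj i i+1<n)) ⟩
      B + b + (B + b) - + 2 * (B - c)
        ≡⟨ lem₁ B b c ⟩
      + 2 * (b + c) ∎
      where open ≡-Reasoning

-- Permutations of the same size

increasing-lower : ∀ {m} (g : Fin m → ℕ) → (∀ i j → i F.< j → g i ℕ.< g j) →
  ∀ c → (∀ i → c ℕ.≤ g i) → ∀ i → c ℕ.+ toℕ i ℕ.≤ g i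
increasing-lower g mono c low zero    = subst (ℕ._≤ g zero) (sym (ℕₚ.+-identityʳ c)) (low zero)
increasing-lower g mono c low (suc i) = subst (ℕ._≤ g (suc i)) (sym (ℕₚ.+-suc c (toℕ i)))
  (increasing-lower (g ∘ suc) (λ i j i<j → mono (suc i) (suc j) (s≤s i<j)) (suc c)
    (λ j → ℕₚ.≤-<-trans (low zero) (mono zero (suc j) (s≤s z≤n))) i)

opposite-antitone : ∀ {m} {i j : Fin m} → i F.< j → opposite j F.< opposite i
opposite-antitone {m} {i} {j} i<j rewrite Fₚ.opposite-prop i | Fₚ.opposite-prop j =
  ℕₚ.∸-monoʳ-< (s≤s i<j) (Fₚ.toℕ<n j)

-- The bound i ≤ f i for increasing maps is applied to `f` and to its conjugate by `opposite`, where
-- it becomes f i ≤ i.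
increasing⇒id : ∀ {k} (f : Fin k → Fin k) → (∀ i j → i F.< j → f i F.< f j) → ∀ i → f i ≡ i
increasing⇒id f mono i = Fₚ.toℕ-injective (ℕₚ.≤-antisym upper (increasing-lower (toℕ ∘ f) mono 0 (λ _ → z≤n) i))
  where
  f° : Fin _ → Fin _
  f° = opposite ∘ f ∘ opposite
  f°-lower : toℕ (opposite i) ℕ.≤ toℕ (f° (opposite i))
  f°-lower = increasing-lower (toℕ ∘ f°)
    (λ i j i<j → opposite-antitone (mono _ _ (opposite-antitone i<j))) 0 (λ _ → z≤n) (opposite i)
  upper : toℕ (f i) ℕ.≤ toℕ i
  upper = ℕₚ.≮⇒≥ λ i<fi → ℕₚ.<⇒≱ (opposite-antitone i<fi)
    (subst (λ j → toℕ (opposite i) ℕ.≤ toℕ (opposite (f j))) (Fₚ.opposite-involutive i) f°-lower)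

-- Pigeonhole: punching out a missed value would inject `Fin (suc k)` into `Fin k`.
perm-surjective : ∀ {k} (π : Vec (Fin k) k) → IsPerm π → ∀ y → ∃ λ i → lookup π i ≡ y
perm-surjective {suc k} π inj y with Fₚ.any? (λ i → lookup π i Fₚ.≟ y)
... | yes hit = hit
... | no miss = contradiction (Fₚ.injective⇒≤ {f = λ i → punchOut (avoid i)}
        (λ {i} {j} e → inj i j (Fₚ.punchOut-injective (avoid i) (avoid j) e))) ℕₚ.1+n≰n
  where
  avoid : ∀ i → y ≢ lookup π i
  avoid i e = miss (i , sym e)

lookup-ext : ∀ {m} {xs ys : Vec A m} → (∀ i → lookup xs i ≡ lookup ys i) → xs ≡ ys
lookup-ext {xs = xs} {ys} h =
  ≡.trans (sym (Vecₚ.tabulate∘lookup xs)) (≡.trans (Vecₚ.tabulate-cong h) (Vecₚ.tabulate∘lookup ys))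

SamePattern : ∀ {k} → Vec (Fin k) k → Vec (Fin k) k → Set
SamePattern {k} π σ = ∀ (i j : Fin k) → i F.< j → (lookup π i F.< lookup π j ⇔ lookup σ i F.< lookup σ j)

-- The map σ ∘ π⁻¹ is increasing on values, hence the identity.
samePattern⇒≡ : ∀ {k} {π σ : Vec (Fin k) k} → IsPerm π → IsPerm σ → SamePattern π σ → π ≡ σ
samePattern⇒≡ {k} {π} {σ} πp σp same = lookup-ext λ j →
  sym (≡.trans (cong (lookup σ) (sym (πp _ _ (π-inv (lookup π j))))) (increasing⇒id g g-mono (lookup π j)))
  where
  inv : Fin k → Fin k
  inv y = proj₁ (perm-surjective π πp y)
  π-inv : ∀ y → lookup π (inv y) ≡ y
  π-inv y = proj₂ (perm-surjective π πp y)
  g : Fin k → Fin k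
  g y = lookup σ (inv y)
  preserves : ∀ i j → lookup π i F.< lookup π j → lookup σ i F.< lookup σ j
  preserves i j lt with Fₚ.<-cmp i j
  ... | tri< i<j _ _  = to (same i j i<j) lt
  ... | tri≈ _ refl _ = contradiction lt (ℕₚ.<-irrefl refl)
  -- The pattern compares only pairs in positional order; for a reversed pair, distinctness of the
  -- values of σ turns "not less" into "greater".
  ... | tri> _ i≢j j<i = Fₚ.≤∧≢⇒< (ℕₚ.≮⇒≥ (λ gt → ℕₚ.<-asym lt (from (same j i j<i) gt))) (i≢j ∘ σp i j)
  g-mono : ∀ x y → x F.< y → g x F.< g y
  g-mono x y x<y = preserves (inv x) (inv y)
    (≡.subst₂ F._<_ (sym (π-inv x)) (sym (π-inv y)) x<y)

-- An increasing embedding of [k] into itself is the identity, so in size k the avoiders of Π are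
-- exactly the permutations outside Π.
contains⇔≡ : ∀ {k} (π σ : Vec (Fin k) k) → IsPerm π → IsPerm σ → Contains π σ ⇔ π ≡ σ
contains⇔≡ π σ πp σp = mk⇔
  (λ { (f , mono , same) → samePattern⇒≡ πp σp (λ i j i<j →
       ≡.subst₂ (λ a b → lookup π i F.< lookup π j ⇔ lookup σ a F.< lookup σ b)
         (increasing⇒id f mono i) (increasing⇒id f mono j) (same i j i<j)) })
  (λ { refl → id , (λ _ _ → id) , (λ _ _ _ → mk⇔ id id) })

-- Permutations with prescribed values

increasing⇒unique : ∀ {k} {xs : List (Fin k)} → Linked F._<_ xs → Unique xs
increasing⇒unique = AllPairs.map Fₚ.<⇒≢ ∘ Linked⇒AllPairs Fₚ.<-trans

⟨$⟩ʳ-injective : ∀ {k} (ρ : Permutation k k) {i j} → ρ ⟨$⟩ʳ i ≡ ρ ⟨$⟩ʳ j → i ≡ j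
⟨$⟩ʳ-injective ρ e = ≡.trans (sym (inverseˡ ρ)) (≡.trans (cong (ρ ⟨$⟩ˡ_) e) (inverseˡ ρ))

transpose-left : ∀ {k} (a b : Fin k) → transpose a b ⟨$⟩ʳ a ≡ b
transpose-left a b with a Fₚ.≟ a
... | yes _  = refl
... | no a≢a = contradiction refl a≢a

transpose-other : ∀ {k} (a b : Fin k) {c} → c ≢ a → c ≢ b → transpose a b ⟨$⟩ʳ c ≡ c
transpose-other a b {c} c≢a c≢b with c Fₚ.≟ a
... | yes c≡a = contradiction c≡a c≢a
... | no _ with c Fₚ.≟ b
...   | yes c≡b = contradiction c≡b c≢b
...   | no _    = refl

-- Each new pair (a, b) is repaired by a final transposition of ρ a and b; the earlier prescribed
-- values differ from both and stay put.
interpolate : ∀ {k} (ps : List (Fin k × Fin k)) → Unique (map proj₁ ps) → Unique (map proj₂ ps) →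
  Σ (Permutation k k) λ ρ → All (λ p → ρ ⟨$⟩ʳ proj₁ p ≡ proj₂ p) ps
interpolate []             _          _          = Perm.id , []
interpolate ((a , b) ∷ ps) (a∉ ∷ ua) (b∉ ∷ ub) with interpolate ps ua ub
... | ρ , ok = ρ ∘ₚ transpose (ρ ⟨$⟩ʳ a) b , transpose-left (ρ ⟨$⟩ʳ a) b ∷ rest ps a∉ b∉ ok
  where
  rest : ∀ ps → All (a ≢_) (map proj₁ ps) → All (b ≢_) (map proj₂ ps) →
    All (λ p → ρ ⟨$⟩ʳ proj₁ p ≡ proj₂ p) ps →
    All (λ p → (ρ ∘ₚ transpose (ρ ⟨$⟩ʳ a) b) ⟨$⟩ʳ proj₁ p ≡ proj₂ p) ps
  rest []             _         _         _         = []
  rest ((x , y) ∷ ps) (a≢x ∷ p) (b≢y ∷ q) (e ∷ ok) =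
    ≡.trans (transpose-other _ b (λ eq → a≢x (sym (⟨$⟩ʳ-injective ρ eq))) (λ eq → b≢y (≡.trans (sym eq) e))) e ∷ rest ps p q ok

-- Counting

allVecs≡cartesian : ∀ (xs : List A) n → allVecs xs (suc n) ≡ cartesianProductWith _∷_ xs (allVecs xs n)
allVecs≡cartesian {A} xs n = go xs
  where
  go : ∀ (ys : List A) → concatMap (λ x → map (x ∷_) (allVecs xs n)) ys ≡ cartesianProductWith _∷_ ys (allVecs xs n)
  go []       = refl
  go (y ∷ ys) = cong (map (y ∷_) (allVecs xs n) ++_) (go ys)

allVecs-unique : ∀ {xs : List A} n → Unique xs → Unique (allVecs xs n)
allVecs-unique zero    u = [] ∷ []
allVecs-unique {xs = xs} (suc n) u rewrite allVecs≡cartesian xs n =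
  Uniqueₚ.cartesianProductWith⁺ _∷_ Vecₚ.∷-injective u (allVecs-unique n u)

allVecs-complete : ∀ {xs : List A} → (∀ x → x ∈ xs) → ∀ {n} (v : Vec A n) → v ∈ allVecs xs n
allVecs-complete all []      = here refl
allVecs-complete {xs = xs} all {suc n} (x ∷ v) rewrite allVecs≡cartesian xs n =
  ∈ₚ.∈-cartesianProductWith⁺ _∷_ (all x) (allVecs-complete all v)

allMaps-unique : ∀ n → Unique (allMaps n)
allMaps-unique n = allVecs-unique n (Uniqueₚ.allFin⁺ n)

allMaps-complete : ∀ {n} (σ : Vec (Fin n) n) → σ ∈ allMaps n
allMaps-complete = allVecs-complete ∈ₚ.∈-allFin

unique-length : ∀ {xs ys : List A} → Unique xs → Unique ys → (∀ {x} → x ∈ xs ⇔ x ∈ ys) → length xs ≡ length ys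
unique-length u v same = ↭-length (∼bag⇒↭ (unique∧set⇒bag u v same))

Count-filter : ∀ {P : A → Set} (P? : Decidable P) xs → Count P xs (length (filter P? xs))
Count-filter P? []       = nil
Count-filter P? (x ∷ xs) with P? x
... | yes p = Count.yes p (Count-filter P? xs)
... | no ¬p = Count.no ¬p (Count-filter P? xs)

Count-unique : ∀ {P Q : A → Set} → (∀ x → P x ⇔ Q x) → ∀ {xs c d} → Count P xs c → Count Q xs d → c ≡ d
Count-unique eq nil        nil        = refl
Count-unique eq (Count.yes p cs) (Count.yes q ds) = cong suc (Count-unique eq cs ds)
Count-unique eq (Count.yes p cs) (Count.no ¬q ds) = contradiction (to (eq _) p) ¬q
Count-unique eq (Count.no ¬p cs) (Count.yes q ds) = contradiction (from (eq _) q) ¬p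
Count-unique eq (Count.no ¬p cs) (Count.no ¬q ds) = Count-unique eq cs ds

Count-cong : ∀ {P Q : A → Set} → (∀ x → P x ⇔ Q x) → ∀ {xs c} → Count P xs c → Count Q xs c
Count-cong eq nil        = nil
Count-cong eq (Count.yes p cs) = Count.yes (to (eq _) p) (Count-cong eq cs)
Count-cong eq (Count.no ¬p cs) = Count.no (¬p ∘ from (eq _)) (Count-cong eq cs)

filter-split : ∀ {P Q : A → Set} (P? : Decidable P) (Q? : Decidable Q) xs →
  length (filter P? xs) ≡
    length (filter (λ x → P? x ×-dec Q? x) xs) ℕ.+ length (filter (λ x → P? x ×-dec ¬? (Q? x)) xs)
filter-split P? Q? []       = refl
filter-split P? Q? (x ∷ xs) with P? x | Q? x
... | yes _ | yes _ = cong suc (filter-split P? Q? xs)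
... | yes _ | no _  = ≡.trans (cong suc (filter-split P? Q? xs)) (sym (ℕₚ.+-suc _ _))
... | no _  | yes _ = filter-split P? Q? xs
... | no _  | no _  = filter-split P? Q? xs

indicator : {P : Set} → Dec P → ℤ
indicator (yes _) = 1ℤ
indicator (no _)  = 0ℤ

indicator-× : {P Q R : Set} (p : Dec P) (q : Dec Q) (r : Dec R) → P ⇔ (Q × R) → indicator p ≡ indicator q * indicator r
indicator-× (yes p) (yes q) (yes r) eq = refl
indicator-× (yes p) (yes q) (no ¬r) eq = contradiction (proj₂ (to eq p)) ¬r
indicator-× (yes p) (no ¬q) _       eq = contradiction (proj₁ (to eq p)) ¬q
indicator-× (no ¬p) (yes q) (yes r) eq = contradiction (from eq (q , r)) ¬p
indicator-× (no ¬p) (yes q) (no ¬r) eq = refl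
indicator-× (no ¬p) (no ¬q) _       eq = refl

indicator-bit : {P : Set} (p : Dec P) → Bit (indicator p)
indicator-bit (yes _) = inj₂ refl
indicator-bit (no _)  = inj₁ refl

filter-indicator : ∀ {P : A → Set} (P? : Decidable P) xs → + length (filter P? xs) ≡ ∑ xs (indicator ∘ P?)
filter-indicator P? []       = refl
filter-indicator P? (x ∷ xs) with P? x
... | yes _ = cong (_+_ 1ℤ) (filter-indicator P? xs)
... | no _  = ≡.trans (filter-indicator P? xs) (sym (ℤₚ.+-identityˡ _))

-- The symmetric group acting on positions

relabel : ∀ {k} → Permutation k k → Vec (Fin k) k → Vec (Fin k) k
relabel ρ σ = tabulate (λ i → lookup σ (ρ ⟨$⟩ʳ i))

lookup-relabel : ∀ {k} (ρ : Permutation k k) σ i → lookup (relabel ρ σ) i ≡ lookup σ (ρ ⟨$⟩ʳ i)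
lookup-relabel ρ σ i = Vecₚ.lookup∘tabulate _ i

relabel-flip : ∀ {k} (ρ : Permutation k k) σ → relabel ρ (relabel (Perm.flip ρ) σ) ≡ σ
relabel-flip ρ σ = lookup-ext λ i → ≡.trans (lookup-relabel ρ (relabel (Perm.flip ρ) σ) i)
  (≡.trans (lookup-relabel (Perm.flip ρ) σ _) (cong (lookup σ) (inverseˡ ρ)))

relabel-injective : ∀ {k} (ρ : Permutation k k) {σ σ′} → relabel ρ σ ≡ relabel ρ σ′ → σ ≡ σ′
relabel-injective ρ {σ} {σ′} e = ≡.trans (sym (relabel-flip (Perm.flip ρ) σ))
  (≡.trans (cong (relabel (Perm.flip ρ)) e) (relabel-flip (Perm.flip ρ) σ′))

relabel-perm : ∀ {k} (ρ : Permutation k k) σ → IsPerm σ → IsPerm (relabel ρ σ)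
relabel-perm ρ σ σp i j e =
  ⟨$⟩ʳ-injective ρ (σp _ _ (≡.trans (sym (lookup-relabel ρ σ i)) (≡.trans e (lookup-relabel ρ σ j))))

IsPerm? : ∀ {n} → Decidable (IsPerm {n})
IsPerm? σ = Fₚ.all? λ i → Fₚ.all? λ j → (lookup σ i Fₚ.≟ lookup σ j) →-dec (i Fₚ.≟ j)

FTerm? : ∀ {n m} (e : Vec ℕ m) → Decidable (λ (σ : Vec (Fin n) n) → FTerm σ e)
FTerm? e σ = (length (word e) ℕₚ.≟ _) ×-dec Fₚ.all? λ i → Fₚ.all? λ j →
  ((toℕ j ℕₚ.≟ suc (toℕ i)) ×-dec (lookup σ j Fₚ.<? lookup σ i)) →-dec (_ ℕₚ.<? _)

-- Passing symmetry from the avoiders to the pattern set.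

module Transfer {k} (Π : List (Vec (Fin k) k)) (perms : All IsPerm Π) (unique : Unique Π)
                (symmetric : IsSymmetric Π k) where

  open import Data.List.Membership.DecPropositional (Vecₚ.≡-dec {n = k} (Fₚ._≟_ {k})) using (_∈?_)

  private
    S : List (Vec (Fin k) k)
    S = allMaps k

    Adm? : ∀ {m} (e : Vec ℕ m) → Decidable (λ (σ : Vec (Fin k) k) → IsPerm σ × FTerm σ e)
    Adm? e σ = IsPerm? σ ×-dec FTerm? e σ

    avoiders : ∀ {m} (e : Vec ℕ m) σ →
      (IsPerm σ × AvoidsAll Π σ × FTerm σ e) ⇔ ((IsPerm σ × FTerm σ e) × σ ∉ Π)
    avoiders e σ = mk⇔
      (λ { (p , av , f) → (p , f) , λ σ∈Π →
           All.lookup av σ∈Π (from (contains⇔≡ _ σ (All.lookup perms σ∈Π) p) refl) })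
      (λ { ((p , f) , σ∉Π) → p , All.tabulate (λ {π} π∈Π c → σ∉Π
             (subst (_∈ Π) (to (contains⇔≡ _ σ (All.lookup perms π∈Π) p) c) π∈Π)) , f })

    -- Symmetry speaks of the relation `Count`: filtering supplies a count at `e`, and
    -- `Count-unique` identifies the transported count with the filtered one.
    avoider-count : ∀ {m} (e : Vec ℕ m) τ → IsPerm τ →
      length (filter (λ σ → Adm? e σ ×-dec ¬? (σ ∈? Π)) S) ≡
      length (filter (λ σ → Adm? (permuteExp e τ) σ ×-dec ¬? (σ ∈? Π)) S)
    avoider-count e τ τp = Count-unique (avoiders (permuteExp e τ))
      (symmetric _ e τ τp _ (Count-cong (λ σ → mk⇔ (from (avoiders e σ)) (to (avoiders e σ))) (Count-filter _ S)))
      (Count-filter _ S)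

    member-count : ∀ {m} (e : Vec ℕ m) →
      length (filter (λ σ → Adm? e σ ×-dec (σ ∈? Π)) S) ≡ length (filter (FTerm? e) Π)
    member-count e = unique-length
      (Uniqueₚ.filter⁺ (λ σ → Adm? e σ ×-dec (σ ∈? Π)) (allMaps-unique k)) (Uniqueₚ.filter⁺ (FTerm? e) unique)
      (mk⇔
        (λ σ∈ → let _ , (_ , f) , σ∈Π = ∈ₚ.∈-filter⁻ (λ σ → Adm? e σ ×-dec (σ ∈? Π)) {xs = S} σ∈
                in ∈ₚ.∈-filter⁺ (FTerm? e) σ∈Π f)
        (λ σ∈ → let σ∈Π , f = ∈ₚ.∈-filter⁻ (FTerm? e) {xs = Π} σ∈
                in ∈ₚ.∈-filter⁺ (λ σ → Adm? e σ ×-dec (σ ∈? Π)) (allMaps-complete _)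
                     ((All.lookup perms σ∈Π , f) , σ∈Π)))

  -- Relabelling positions by ρ is a bijection between the contributing permutations of S_k for the
  -- two monomials. Subtracting the avoiders, whose numbers agree by symmetry, leaves the members of
  -- Π.
  transfer : ∀ {m} (e : Vec ℕ m) τ → IsPerm τ → (ρ : Permutation k k) →
    (∀ σ → FTerm σ e ⇔ FTerm (relabel ρ σ) (permuteExp e τ)) →
    length (filter (FTerm? e) Π) ≡ length (filter (FTerm? (permuteExp e τ)) Π)
  transfer e τ τp ρ move = begin
    length (filter (FTerm? e) Π)                          ≡⟨ member-count e ⟨
    length (filter (λ σ → Adm? e σ ×-dec (σ ∈? Π)) S)     ≡⟨ ℕₚ.+-cancelʳ-≡ _ _ _ totals ⟩
    length (filter (λ σ → Adm? e′ σ ×-dec (σ ∈? Π)) S)    ≡⟨ member-count e′ ⟩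
    length (filter (FTerm? e′) Π) ∎
    where
    open ≡-Reasoning
    e′ = permuteExp e τ
    image : ∀ {σ} → σ ∈ map (relabel ρ) (filter (Adm? e) S) ⇔ σ ∈ filter (Adm? e′) S
    image {σ} = mk⇔
      (λ σ∈ → let σ′ , σ′∈ , eq = ∈ₚ.∈-map⁻ (relabel ρ) σ∈
                  _ , p , f = ∈ₚ.∈-filter⁻ (Adm? e) {xs = S} σ′∈
              in ∈ₚ.∈-filter⁺ (Adm? e′) (allMaps-complete σ)
                   (subst (λ σ → IsPerm σ × FTerm σ e′) (sym eq) (relabel-perm ρ σ′ p , to (move σ′) f)))
      (λ σ∈ → let _ , p , f = ∈ₚ.∈-filter⁻ (Adm? e′) {xs = S} σ∈
                  σ′ = relabel (Perm.flip ρ) σ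
                  eq = relabel-flip ρ σ
              in subst (_∈ map (relabel ρ) (filter (Adm? e) S)) eq
                   (∈ₚ.∈-map⁺ (relabel ρ) (∈ₚ.∈-filter⁺ (Adm? e) (allMaps-complete σ′)
                     (relabel-perm (Perm.flip ρ) σ p , from (move σ′) (subst (λ σ → FTerm σ e′) (sym eq) f)))))
    -- The count of nonmembers is taken at `e′` on both sides so that it cancels.
    totals : length (filter (λ σ → Adm? e σ ×-dec (σ ∈? Π)) S) ℕ.+
               length (filter (λ σ → Adm? e′ σ ×-dec ¬? (σ ∈? Π)) S) ≡
             length (filter (λ σ → Adm? e′ σ ×-dec (σ ∈? Π)) S) ℕ.+
               length (filter (λ σ → Adm? e′ σ ×-dec ¬? (σ ∈? Π)) S)
    totals = begin
      _ ≡⟨ cong (length (filter (λ σ → Adm? e σ ×-dec (σ ∈? Π)) S) ℕ.+_) (avoider-count e τ τp) ⟨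
      _ ≡⟨ filter-split (Adm? e) (_∈? Π) S ⟨
      length (filter (Adm? e) S) ≡⟨ Listₚ.length-map (relabel ρ) (filter (Adm? e) S) ⟨
      length (map (relabel ρ) (filter (Adm? e) S))
        ≡⟨ unique-length (Uniqueₚ.map⁺ (relabel-injective ρ) (Uniqueₚ.filter⁺ (Adm? e) (allMaps-unique k)))
                         (Uniqueₚ.filter⁺ (Adm? e′) (allMaps-unique k)) image ⟩
      length (filter (Adm? e′) S) ≡⟨ filter-split (Adm? e′) (_∈? Π) S ⟩
      _ ∎

-- Index words and descents

-- Positions are natural numbers, so that dropping the first entry is composition with `suc`; beyond
-- the end the value is 0.
val : ∀ {k m} → Vec (Fin k) m → ℕ → ℕ
val []      _       = 0
val (x ∷ v) zero    = toℕ x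
val (x ∷ v) (suc i) = val v i

val-lookup : ∀ {k m} (v : Vec (Fin k) m) i → val v (toℕ i) ≡ toℕ (lookup v i)
val-lookup (x ∷ v) zero    = refl
val-lookup (x ∷ v) (suc i) = val-lookup v i

-- For a permutation, whose values are distinct, this is an ascent at any i with i + 1 in range.
NoDrop : (ℕ → ℕ) → ℕ → Set
NoDrop s i = ¬ (s (suc i) ℕ.< s i)

NoDrop? : ∀ s i → Dec (NoDrop s i)
NoDrop? s i = ¬? (s (suc i) ℕₚ.<? s i)

Fits : List ℕ → (ℕ → ℕ) → Set
Fits w s = ∀ i → suc i ℕ.< length w → s (suc i) ℕ.< s i → at w i ℕ.< at w (suc i)

FTerm⇔Fits : ∀ {n m} (e : Vec ℕ m) → length (word e) ≡ n → (σ : Vec (Fin n) n) → FTerm σ e ⇔ Fits (word e) (val σ)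
FTerm⇔Fits {n} e len σ = mk⇔ forth back
  where
  w = word e
  forth : FTerm σ e → Fits w (val σ)
  forth (_ , f) i i+1<w drop = ≡.subst₂ (λ x y → at w x ℕ.< at w y) ea eb
    (f a b (≡.trans eb (cong suc (sym ea)) , ≡.subst₂ ℕ._<_
      (≡.trans (cong (val σ) (sym eb)) (val-lookup σ b)) (≡.trans (cong (val σ) (sym ea)) (val-lookup σ a)) drop))
    where
    i+1<n : suc i ℕ.< n
    i+1<n = subst (suc i ℕ.<_) len i+1<w
    i<n : i ℕ.< n
    i<n = ℕₚ.<-trans (ℕₚ.n<1+n i) i+1<n
    a b : Fin n
    a = fromℕ< i<n
    b = fromℕ< i+1<n
    ea : toℕ a ≡ i
    ea = Fₚ.toℕ-fromℕ< i<n
    eb : toℕ b ≡ suc i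
    eb = Fₚ.toℕ-fromℕ< i+1<n
  back : Fits w (val σ) → FTerm σ e
  back fits = len , λ { i j (j≡1+i , σj<σi) → subst (λ x → at w (toℕ i) ℕ.< at w x) (sym j≡1+i)
    (fits (toℕ i) (≡.subst₂ ℕ._<_ j≡1+i (sym len) (Fₚ.toℕ<n j))
      (≡.subst₂ ℕ._<_ (≡.trans (sym (val-lookup σ j)) (cong (val σ) j≡1+i)) (sym (val-lookup σ i)) σj<σi)) }

wordFrom-head : ∀ {m} j (e : Vec ℕ m) → 0 ℕ.< length (wordFrom j e) → j ℕ.≤ at (wordFrom j e) 0
wordFrom-head j (zero ∷ e)  lt = ℕₚ.≤-trans (ℕₚ.n≤1+n j) (wordFrom-head (suc j) e lt)
wordFrom-head j (suc c ∷ e) lt = ℕₚ.≤-refl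

length-wordFrom : ∀ {m} j (e : Vec ℕ m) → length (wordFrom j e) ≡ Vec.sum e
length-wordFrom j []      = refl
length-wordFrom j (c ∷ e) = ≡.trans (Listₚ.length-++ (List.replicate c j))
  (cong₂ ℕ._+_ (Listₚ.length-replicate c) (length-wordFrom (suc j) e))

-- The letter after j, if any, exceeds j, so a descent at this place is harmless.
Fits-rise : ∀ {m} j (e : Vec ℕ m) s → Fits (j ∷ wordFrom (suc j) e) s ⇔ Fits (wordFrom (suc j) e) (s ∘ suc)
Fits-rise j e s = mk⇔ (λ fits i lt → fits (suc i) (s≤s lt))
  λ { fits zero (s≤s lt) _ → wordFrom-head (suc j) e lt ; fits (suc i) (s≤s lt) drop → fits i lt drop }

-- A repeated letter is precisely what forbids a descent.
Fits-flat : ∀ j w s → Fits (j ∷ j ∷ w) s ⇔ (NoDrop s 0 × Fits (j ∷ w) (s ∘ suc))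
Fits-flat j w s = mk⇔
  (λ fits → (λ drop → ℕₚ.<-irrefl refl (fits 0 (s≤s (s≤s z≤n)) drop)) , (λ i lt → fits (suc i) (s≤s lt)))
  λ { (up , fits) zero _ drop → contradiction drop up ; (up , fits) (suc i) (s≤s lt) drop → fits i lt drop }

ones : ∀ m → Vec ℕ m
ones m = Vec.replicate m 1

Fits-ones : ∀ m j s → Fits (wordFrom j (ones m)) s
Fits-ones zero    j s i ()
Fits-ones (suc m) j s = from (Fits-rise j (ones m) s) (Fits-ones m (suc j) (s ∘ suc))

Fits-two : ∀ {m} (i : Fin m) j s → Fits (wordFrom j (ones m [ i ]≔ 2)) s ⇔ NoDrop s (toℕ i)
Fits-two {suc m} zero    j s = mk⇔ (proj₁ ∘ to flat)
  (λ up → from flat (up , from (Fits-rise j (ones m) (s ∘ suc)) (Fits-ones m (suc j) (λ i → s (2 ℕ.+ i)))))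
  where flat = Fits-flat j (wordFrom (suc j) (ones m)) s
Fits-two {suc m} (suc i) j s = mk⇔ (to ih ∘ to rise) (from rise ∘ from ih)
  where
  rise = Fits-rise j (ones m [ i ]≔ 2) s
  ih = Fits-two i (suc j) (s ∘ suc)

Fits-three : ∀ {m} (i : Fin m) j s →
  Fits (wordFrom j (ones m [ i ]≔ 3)) s ⇔ (NoDrop s (toℕ i) × NoDrop s (suc (toℕ i)))
Fits-three {suc m} zero    j s = mk⇔
  (λ fits → let up , fits′ = to flat fits in up , proj₁ (to flat′ fits′))
  (λ { (up , up′) → from flat (up , from flat′ (up′ ,
         from (Fits-rise j (ones m) (λ i → s (2 ℕ.+ i))) (Fits-ones m (suc j) (λ i → s (3 ℕ.+ i))))) })
  where
  flat = Fits-flat j (j ∷ wordFrom (suc j) (ones m)) s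
  flat′ = Fits-flat j (wordFrom (suc j) (ones m)) (s ∘ suc)
Fits-three {suc m} (suc i) j s = mk⇔ (to ih ∘ to rise) (from rise ∘ from ih)
  where
  rise = Fits-rise j (ones m [ i ]≔ 3) s
  ih = Fits-three i (suc j) (s ∘ suc)

-- The extra copy of the first doubled letter shifts the second repetition one place to the right,
-- hence the `suc`.
Fits-two-two : ∀ {m} (i i′ : Fin m) → i F.< i′ → ∀ j s →
  Fits (wordFrom j ((ones m [ i ]≔ 2) [ i′ ]≔ 2)) s ⇔ (NoDrop s (toℕ i) × NoDrop s (suc (toℕ i′)))
Fits-two-two {suc m} zero (suc i′) _ j s = mk⇔
  (λ fits → let up , fits′ = to flat fits in up , to two (to rise fits′))
  (λ { (up , up′) → from flat (up , from rise (from two up′)) })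
  where
  e = ones m [ i′ ]≔ 2
  flat = Fits-flat j (wordFrom (suc j) e) s
  rise = Fits-rise j e (s ∘ suc)
  two = Fits-two i′ (suc j) (λ i → s (2 ℕ.+ i))
Fits-two-two {suc m} (suc i) (suc i′) (s≤s i<i′) j s = mk⇔ (to ih ∘ to rise) (from rise ∘ from ih)
  where
  rise = Fits-rise j ((ones m [ i ]≔ 2) [ i′ ]≔ 2) s
  ih = Fits-two-two i i′ i<i′ (suc j) (s ∘ suc)

-- Gram matrix of the ascent indicators

permuteExp-ones : ∀ {m} (τ : Vec (Fin m) m) → permuteExp (ones m) τ ≡ ones m
permuteExp-ones {m} τ = lookup-ext λ j → ≡.trans (Vecₚ.lookup∘tabulate _ j)
  (≡.trans (Vecₚ.lookup-replicate (lookup τ j) 1) (sym (Vecₚ.lookup-replicate j 1)))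

permuteExp-update : ∀ {m} (e : Vec ℕ m) (τ : Vec (Fin m) m) → IsPerm τ → ∀ {i i′} v → lookup τ i′ ≡ i →
  permuteExp (e [ i ]≔ v) τ ≡ permuteExp e τ [ i′ ]≔ v
permuteExp-update e τ τp {i′ = i′} v refl = lookup-ext λ j → ≡.trans (Vecₚ.lookup∘tabulate _ j) (entry j)
  where
  entry : ∀ j → lookup (e [ lookup τ i′ ]≔ v) (lookup τ j) ≡ lookup (permuteExp e τ [ i′ ]≔ v) j
  entry j with j Fₚ.≟ i′
  ... | yes refl = ≡.trans (Vecₚ.lookup∘update (lookup τ j) e v) (sym (Vecₚ.lookup∘update j (permuteExp e τ) v))
  ... | no j≢i′  = begin
    lookup (e [ lookup τ i′ ]≔ v) (lookup τ j) ≡⟨ Vecₚ.lookup∘update′ (j≢i′ ∘ τp j i′) e v ⟩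
    lookup e (lookup τ j)                      ≡⟨ Vecₚ.lookup∘tabulate _ j ⟨
    lookup (permuteExp e τ) j                  ≡⟨ Vecₚ.lookup∘update′ j≢i′ (permuteExp e τ) v ⟨
    lookup (permuteExp e τ [ i′ ]≔ v) j        ∎
    where open ≡-Reasoning

sum-ones : ∀ m → Vec.sum (ones m) ≡ m
sum-ones zero    = refl
sum-ones (suc m) = cong suc (sum-ones m)

sum-update : ∀ {m} (e : Vec ℕ m) i v → lookup e i ≡ 1 → Vec.sum (e [ i ]≔ suc v) ≡ v ℕ.+ Vec.sum e
sum-update (_ ∷ e) zero    v refl = sym (ℕₚ.+-suc v (Vec.sum e))
sum-update (c ∷ e) (suc i) v eq   = begin
  c ℕ.+ Vec.sum (e [ i ]≔ suc v) ≡⟨ cong (c ℕ.+_) (sum-update e i v eq) ⟩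
  c ℕ.+ (v ℕ.+ Vec.sum e)        ≡⟨ ℕₚ.+-assoc c v _ ⟨
  c ℕ.+ v ℕ.+ Vec.sum e          ≡⟨ cong (ℕ._+ Vec.sum e) (ℕₚ.+-comm c v) ⟩
  v ℕ.+ c ℕ.+ Vec.sum e          ≡⟨ ℕₚ.+-assoc v c _ ⟩
  v ℕ.+ (c ℕ.+ Vec.sum e)        ∎
  where open ≡-Reasoning

Rises : ∀ {n} → Vec (Fin n) n → ℕ → Set
Rises σ i = NoDrop (val σ) i

length-spike : ∀ {m} (i : Fin m) v → length (word (ones m [ i ]≔ suc v)) ≡ v ℕ.+ m
length-spike {m} i v = ≡.trans (length-wordFrom 0 (ones m [ i ]≔ suc v))
  (≡.trans (sum-update (ones m) i v (Vecₚ.lookup-replicate i 1)) (cong (v ℕ.+_) (sum-ones m)))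

length-two-spikes : ∀ {m} (i j : Fin m) → i F.< j → length (word ((ones m [ i ]≔ 2) [ j ]≔ 2)) ≡ 2 ℕ.+ m
length-two-spikes {m} i j i<j = ≡.trans (length-wordFrom 0 ((ones m [ i ]≔ 2) [ j ]≔ 2))
  (≡.trans (sum-update (ones m [ i ]≔ 2) j 1
             (≡.trans (Vecₚ.lookup∘update′ (λ j≡i → Fₚ.<⇒≢ i<j (sym j≡i)) (ones m) 2) (Vecₚ.lookup-replicate j 1)))
           (cong suc (≡.trans (sym (length-wordFrom 0 (ones m [ i ]≔ 2))) (length-spike i 1))))

-- The condition is doubled to have the shape of a Gram entry, here a diagonal one.
FTerm-two : ∀ {n} (i : Fin n) (σ : Vec (Fin (suc n)) (suc n)) →
  FTerm σ (ones n [ i ]≔ 2) ⇔ (Rises σ (toℕ i) × Rises σ (toℕ i))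
FTerm-two {n} i σ = mk⇔ (λ f → let up = to two (to eq f) in up , up) (λ { (up , _) → from eq (from two up) })
  where
  eq = FTerm⇔Fits (ones n [ i ]≔ 2) (length-spike i 1) σ
  two = Fits-two i 0 (val σ)

FTerm-three : ∀ {n} (i : Fin n) (σ : Vec (Fin (2 ℕ.+ n)) (2 ℕ.+ n)) →
  FTerm σ (ones n [ i ]≔ 3) ⇔ (Rises σ (toℕ i) × Rises σ (suc (toℕ i)))
FTerm-three {n} i σ = mk⇔ (to three ∘ to eq) (from eq ∘ from three)
  where
  eq = FTerm⇔Fits (ones n [ i ]≔ 3) (length-spike i 2) σ
  three = Fits-three i 0 (val σ)

FTerm-two-two : ∀ {n} (i j : Fin n) → i F.< j → (σ : Vec (Fin (2 ℕ.+ n)) (2 ℕ.+ n)) →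
  FTerm σ ((ones n [ i ]≔ 2) [ j ]≔ 2) ⇔ (Rises σ (toℕ i) × Rises σ (suc (toℕ j)))
FTerm-two-two {n} i j i<j σ = mk⇔ (to two ∘ to eq) (from eq ∘ from two)
  where
  eq = FTerm⇔Fits ((ones n [ i ]≔ 2) [ j ]≔ 2) (length-two-spikes i j i<j) σ
  two = Fits-two-two i j i<j 0 (val σ)

val-relabel : ∀ {k} (ρ : Permutation k k) σ {a a′} → ρ ⟨$⟩ʳ a′ ≡ a → val (relabel ρ σ) (toℕ a′) ≡ val σ (toℕ a)
val-relabel ρ σ {a′ = a′} refl =
  ≡.trans (val-lookup (relabel ρ σ) a′) (≡.trans (cong toℕ (lookup-relabel ρ σ a′)) (sym (val-lookup σ _)))

Rises-relabel : ∀ {n} (ρ : Permutation (suc n) (suc n)) {i i′ : Fin n} →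
  ρ ⟨$⟩ʳ inject₁ i′ ≡ inject₁ i → ρ ⟨$⟩ʳ suc i′ ≡ suc i →
  ∀ σ → Rises σ (toℕ i) ⇔ Rises (relabel ρ σ) (toℕ i′)
Rises-relabel ρ {i} {i′} low high σ = mk⇔ (λ up drop → up (≡.subst₂ ℕ._<_ e₁ e₀ drop))
  (λ up drop → up (≡.subst₂ ℕ._<_ (sym e₁) (sym e₀) drop))
  where
  e₁ : val (relabel ρ σ) (suc (toℕ i′)) ≡ val σ (suc (toℕ i))
  e₁ = val-relabel ρ σ high
  e₀ : val (relabel ρ σ) (toℕ i′) ≡ val σ (toℕ i)
  e₀ = ≡.subst₂ (λ x y → val (relabel ρ σ) x ≡ val σ y) (Fₚ.toℕ-inject₁ i′) (Fₚ.toℕ-inject₁ i) (val-relabel ρ σ low)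

inject₁<suc : ∀ {n} (i : Fin n) → inject₁ i F.< suc i
inject₁<suc i = s≤s (ℕₚ.≤-reflexive (Fₚ.toℕ-inject₁ i))

rise : ∀ {n} → Vec (Fin n) n → ℕ → ℤ
rise σ i = indicator (NoDrop? (val σ) i)

permVec : ∀ {m} → Permutation m m → Vec (Fin m) m
permVec τ = tabulate (τ ⟨$⟩ʳ_)

permVec-perm : ∀ {m} (τ : Permutation m m) → IsPerm (permVec τ)
permVec-perm τ i j e = ⟨$⟩ʳ-injective τ
  (≡.trans (sym (Vecₚ.lookup∘tabulate _ i)) (≡.trans e (Vecₚ.lookup∘tabulate _ j)))

module RiseGram {n} (Π : List (Vec (Fin (2 ℕ.+ n)) (2 ℕ.+ n))) (perms : All IsPerm Π) (unique : Unique Π)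
                (symmetric : IsSymmetric Π (2 ℕ.+ n)) where
  open Transfer Π perms unique symmetric

  gram : ℕ → ℕ → ℤ
  gram i j = ∑ Π (λ π → rise π i * rise π j)

  private
    gram-FTerm : ∀ {m} (e : Vec ℕ m) {i j} → (∀ σ → FTerm σ e ⇔ (Rises σ i × Rises σ j)) →
      + length (filter (FTerm? e) Π) ≡ gram i j
    gram-FTerm e {i} {j} h = ≡.trans (filter-indicator (FTerm? e) Π)
      (∑-cong Π (λ π → indicator-× (FTerm? e π) (NoDrop? (val π) i) (NoDrop? (val π) j) (h π)))

    -- Two permutations cooperate: τ moves the exponents of the monomial, and ρ moves the positions
    -- at which ascents are demanded.
    gram-transfer : ∀ {m} (e e′ : Vec ℕ m) (τ : Permutation m m) → permuteExp e (permVec τ) ≡ e′ →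
      ∀ ρ {i j i′ j′} → (∀ σ → FTerm σ e ⇔ (Rises σ i × Rises σ j)) → (∀ σ → FTerm σ e′ ⇔ (Rises σ i′ × Rises σ j′)) →
      (∀ σ → Rises σ i ⇔ Rises (relabel ρ σ) i′) → (∀ σ → Rises σ j ⇔ Rises (relabel ρ σ) j′) → gram i j ≡ gram i′ j′
    gram-transfer e _ τ refl ρ h h′ mi mj = ≡.trans (sym (gram-FTerm e h))
      (≡.trans (cong +_ (transfer e (permVec τ) (permVec-perm τ) ρ (λ σ → mk⇔
        (λ f → let x , y = to (h σ) f in from (h′ (relabel ρ σ)) (to (mi σ) x , to (mj σ) y))
        (λ f → let x , y = to (h′ (relabel ρ σ)) f in from (h σ) (from (mi σ) x , from (mj σ) y)))))
      (gram-FTerm (permuteExp e (permVec τ)) h′))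

    permVec-at : ∀ {m} (τ : Permutation m m) {i i′} → τ ⟨$⟩ʳ i′ ≡ i → lookup (permVec τ) i′ ≡ i
    permVec-at τ {i′ = i′} e = ≡.trans (Vecₚ.lookup∘tabulate _ i′) e

    spike-move : ∀ {m} (τ : Permutation m m) {i i′} v → τ ⟨$⟩ʳ i′ ≡ i →
      permuteExp (ones m [ i ]≔ v) (permVec τ) ≡ ones m [ i′ ]≔ v
    spike-move {m} τ {i′ = i′} v e = ≡.trans (permuteExp-update (ones m) (permVec τ) (permVec-perm τ) v (permVec-at τ e))
      (cong (_[ i′ ]≔ v) (permuteExp-ones (permVec τ)))

  gram-diagonal : ∀ (i i′ : Fin (suc n)) → gram (toℕ i) (toℕ i) ≡ gram (toℕ i′) (toℕ i′)
  gram-diagonal i i′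
    with interpolate ((i′ , i) ∷ []) ([] ∷ []) ([] ∷ [])
       | interpolate ((inject₁ i′ , inject₁ i) ∷ (suc i′ , suc i) ∷ [])
           (increasing⇒unique (inject₁<suc i′ ∷ [-])) (increasing⇒unique (inject₁<suc i ∷ [-]))
  ... | τ , τ≡ ∷ [] | ρ , low ∷ high ∷ [] =
    gram-transfer (ones (suc n) [ i ]≔ 2) (ones (suc n) [ i′ ]≔ 2) τ (spike-move τ 2 τ≡) ρ
      (FTerm-two i) (FTerm-two i′) (Rises-relabel ρ low high) (Rises-relabel ρ low high)

  private
    Rises-relabel₁ : ∀ (ρ : Permutation (2 ℕ.+ n) (2 ℕ.+ n)) {i i′ : Fin n} →
      ρ ⟨$⟩ʳ inject₁ (inject₁ i′) ≡ inject₁ (inject₁ i) → ρ ⟨$⟩ʳ suc (inject₁ i′) ≡ suc (inject₁ i) →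
      ∀ σ → Rises σ (toℕ i) ⇔ Rises (relabel ρ σ) (toℕ i′)
    Rises-relabel₁ ρ {i} {i′} low high σ = ≡.subst₂ (λ x y → Rises σ x ⇔ Rises (relabel ρ σ) y)
      (Fₚ.toℕ-inject₁ i) (Fₚ.toℕ-inject₁ i′) (Rises-relabel ρ low high σ)

  gram-adjacent : ∀ (i i′ : Fin n) → gram (toℕ i) (suc (toℕ i)) ≡ gram (toℕ i′) (suc (toℕ i′))
  gram-adjacent i i′
    with interpolate ((i′ , i) ∷ []) ([] ∷ []) ([] ∷ [])
       | interpolate ((inject₁ (inject₁ i′) , inject₁ (inject₁ i)) ∷ (suc (inject₁ i′) , suc (inject₁ i)) ∷
                      (suc (suc i′) , suc (suc i)) ∷ [])
           (increasing⇒unique (inject₁<suc (inject₁ i′) ∷ inject₁<suc (suc i′) ∷ [-]))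
           (increasing⇒unique (inject₁<suc (inject₁ i) ∷ inject₁<suc (suc i) ∷ [-]))
  ... | τ , τ≡ ∷ [] | ρ , low ∷ mid ∷ high ∷ [] =
    gram-transfer (ones n [ i ]≔ 3) (ones n [ i′ ]≔ 3) τ (spike-move τ 3 τ≡) ρ
      (FTerm-three i) (FTerm-three i′) (Rises-relabel₁ ρ low mid) (Rises-relabel ρ {suc i} {suc i′} mid high)

  -- As i < j, the positions i, i + 1, j + 1, j + 2 are distinct, so a single ρ can carry both
  -- ascents at once.
  gram-distant : ∀ {i j i′ j′ : Fin n} → i F.< j → i′ F.< j′ →
    gram (toℕ i) (suc (toℕ j)) ≡ gram (toℕ i′) (suc (toℕ j′))
  gram-distant {i} {j} {i′} {j′} i<j i′<j′
    with interpolate ((i′ , i) ∷ (j′ , j) ∷ []) (increasing⇒unique (i′<j′ ∷ [-])) (increasing⇒unique (i<j ∷ [-]))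
       | interpolate ((inject₁ (inject₁ i′) , inject₁ (inject₁ i)) ∷ (suc (inject₁ i′) , suc (inject₁ i)) ∷
                      (suc (inject₁ j′) , suc (inject₁ j)) ∷ (suc (suc j′) , suc (suc j)) ∷ [])
           (increasing i′<j′) (increasing i<j)
    where
    increasing : ∀ {i j : Fin n} → i F.< j →
      Unique (inject₁ (inject₁ i) ∷ suc (inject₁ i) ∷ suc (inject₁ j) ∷ suc (suc j) ∷ [])
    increasing {i} {j} i<j = increasing⇒unique (inject₁<suc (inject₁ i) ∷
      s≤s (≡.subst₂ ℕ._<_ (sym (Fₚ.toℕ-inject₁ i)) (sym (Fₚ.toℕ-inject₁ j)) i<j) ∷ inject₁<suc (suc j) ∷ [-])
  ... | τ , τi ∷ τj ∷ [] | ρ , ilow ∷ ihigh ∷ jlow ∷ jhigh ∷ [] =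
    gram-transfer ((ones n [ i ]≔ 2) [ j ]≔ 2) ((ones n [ i′ ]≔ 2) [ j′ ]≔ 2) τ
      (≡.trans (permuteExp-update (ones n [ i ]≔ 2) (permVec τ) (permVec-perm τ) 2 (permVec-at τ τj))
               (cong (_[ j′ ]≔ 2) (spike-move τ 2 τi)))
      ρ (FTerm-two-two i j i<j) (FTerm-two-two i′ j′ i′<j′)
      (Rises-relabel₁ ρ ilow ihigh) (Rises-relabel ρ {suc j} {suc j′} jlow jhigh)

-- The three parameters are read off columns 0, 1, 2, which represent all equal, adjacent and
-- distant pairs.
rise-pathGram : ∀ {q} (Π : List (Vec (Fin (4 ℕ.+ q)) (4 ℕ.+ q))) → All IsPerm Π → Unique Π → IsSymmetric Π (4 ℕ.+ q) →
  ∃₂ λ B b → ∃ λ c → PathGram Π rise B b c (3 ℕ.+ q)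
rise-pathGram {q} Π perms unique symmetric = B , gram 0 0 - B , B - gram 0 1 , record
  { diag = λ i i<n → ≡.trans
      (subst (λ x → gram x x ≡ gram 0 0) (Fₚ.toℕ-fromℕ< i<n) (gram-diagonal (fromℕ< i<n) zero))
      (lem₁ (gram 0 0) B)
  ; adj = λ { i (s≤s i<n) → ≡.trans
      (subst (λ x → gram x (suc x) ≡ gram 0 1) (Fₚ.toℕ-fromℕ< i<n) (gram-adjacent (fromℕ< i<n) zero))
      (lem₂ (gram 0 1) B) }
  ; far = λ { i j (s≤s j<n) →
      let i<j = s≤s (ℕₚ.m≤m+n i j)
          i<n = ℕₚ.<-trans i<j j<n
      in ≡.subst₂ (λ x y → gram x (suc y) ≡ B) (Fₚ.toℕ-fromℕ< i<n) (Fₚ.toℕ-fromℕ< j<n)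
           (gram-distant {i′ = zero} {suc zero}
             (≡.subst₂ ℕ._<_ (sym (Fₚ.toℕ-fromℕ< i<n)) (sym (Fₚ.toℕ-fromℕ< j<n)) i<j) (s≤s z≤n)) }
  }
  where
  open RiseGram Π perms unique symmetric
  B : ℤ
  B = gram 0 2
  lem₁ : ∀ N B → N ≡ B + (N - B)
  lem₁ = solve-∀
  lem₂ : ∀ A B → A ≡ B - (B - A)
  lem₂ = solve-∀

-- Permutations with constant ascent indicator.

chain : ∀ {R : ℕ → ℕ → Set} → (∀ {x} → R x x) → (∀ {x y z} → R x y → R y z → R x z) →
  ∀ (s : ℕ → ℕ) {k} → (∀ i → suc i ℕ.< k → R (s i) (s (suc i))) → ∀ {a b} → a ℕ.≤′ b → b ℕ.< k → R (s a) (s b)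
chain {R} R-refl R-trans s step ℕ.≤′-refl         b<k = R-refl
chain {R} R-refl R-trans s step (ℕ.≤′-step a≤b) b<k =
  R-trans (chain {R} R-refl R-trans s step a≤b (ℕₚ.<-trans (ℕₚ.n<1+n _) b<k)) (step _ b<k)

indicator-1 : {P : Set} (p : Dec P) → indicator p ≡ 1ℤ → P
indicator-1 (yes p) _ = p

indicator-0 : {P : Set} (p : Dec P) → indicator p ≡ 0ℤ → ¬ P
indicator-0 (no ¬p) _ = ¬p

module _ {n} (π : Vec (Fin (suc n)) (suc n)) (flat : ∀ i → suc i ℕ.< n → rise π i ≡ rise π (suc i)) where

  rise-constant : ∀ i → i ℕ.< n → rise π i ≡ rise π 0
  rise-constant zero    _   = refl
  rise-constant (suc i) i<n = ≡.trans (sym (flat i i<n)) (rise-constant i (ℕₚ.<-trans (ℕₚ.n<1+n i) i<n))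

  rising : IsPerm π → rise π 0 ≡ 1ℤ → ∀ i j → i F.< j → lookup π i F.< lookup π j
  rising πp up i j i<j = Fₚ.≤∧≢⇒<
    (≡.subst₂ ℕ._≤_ (val-lookup π i) (val-lookup π j)
      (chain {ℕ._≤_} ℕₚ.≤-refl ℕₚ.≤-trans (val π)
        (λ { l (s≤s l<n) → ℕₚ.≮⇒≥ (indicator-1 (NoDrop? (val π) l) (≡.trans (rise-constant l l<n) up)) })
        (ℕₚ.≤⇒≤′ (ℕₚ.<⇒≤ i<j)) (Fₚ.toℕ<n j)))
    (Fₚ.<⇒≢ i<j ∘ πp i j)

  falling : rise π 0 ≡ 0ℤ → ∀ i j → i F.< j → ¬ lookup π i F.< lookup π j
  falling down i j i<j = ℕₚ.≤⇒≯
    (≡.subst₂ ℕ._≤_ (val-lookup π j) (val-lookup π i)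
      (chain {ℕ._≥_} ℕₚ.≤-refl (λ x y → ℕₚ.≤-trans y x) (val π)
        (λ { l (s≤s l<n) → ℕₚ.≮⇒≥ (λ lt → indicator-0 (NoDrop? (val π) l)
             (≡.trans (rise-constant l l<n) down) (ℕₚ.<-asym lt)) })
        (ℕₚ.≤⇒≤′ (ℕₚ.<⇒≤ i<j)) (Fₚ.toℕ<n j)))

-- Both permutations are increasing or both are decreasing, according to the common bit at 0.
flat⇒≡ : ∀ {n} {π σ : Vec (Fin (suc n)) (suc n)} → IsPerm π → IsPerm σ →
  (∀ i → suc i ℕ.< n → rise π i ≡ rise π (suc i)) → (∀ i → suc i ℕ.< n → rise σ i ≡ rise σ (suc i)) →
  rise π 0 ≡ rise σ 0 → π ≡ σ
flat⇒≡ {π = π} {σ} πp σp πflat σflat same with indicator-bit (NoDrop? (val σ) 0)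
... | inj₁ down = samePattern⇒≡ πp σp λ i j i<j → mk⇔
  (λ lt → contradiction lt (falling π πflat (≡.trans same down) i j i<j))
  (λ lt → contradiction lt (falling σ σflat down i j i<j))
... | inj₂ up = samePattern⇒≡ πp σp λ i j i<j → mk⇔
  (λ _ → rising σ σflat σp up i j i<j)
  (λ _ → rising π πflat πp (≡.trans same up) i j i<j)

bits-coincide : ∀ {x y z} → Bit x → Bit y → Bit z → x ≡ y ⊎ x ≡ z ⊎ y ≡ z
bits-coincide (inj₁ refl) (inj₁ refl) _           = inj₁ refl
bits-coincide (inj₂ refl) (inj₂ refl) _           = inj₁ refl
bits-coincide (inj₁ refl) (inj₂ refl) (inj₁ refl) = inj₂ (inj₁ refl)
bits-coincide (inj₁ refl) (inj₂ refl) (inj₂ refl) = inj₂ (inj₂ refl)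
bits-coincide (inj₂ refl) (inj₁ refl) (inj₁ refl) = inj₂ (inj₂ refl)
bits-coincide (inj₂ refl) (inj₁ refl) (inj₂ refl) = inj₂ (inj₁ refl)

-- From symmetry in degree k to at most two patterns.

symmetric⇒flat : ∀ {q} (Π : List (Vec (Fin (4 ℕ.+ q)) (4 ℕ.+ q))) → All IsPerm Π → Unique Π →
  4 ℕ.≤ 3 ℕ.+ q → length Π ℕ.< 3 ℕ.+ q → IsSymmetric Π (4 ℕ.+ q) →
  ∀ {π} → π ∈ Π → ∀ i → suc i ℕ.< 3 ℕ.+ q → rise π i ≡ rise π (suc i)
symmetric⇒flat Π perms unique 4≤n p<n symmetric π∈Π i i+1<n =
  let _ , _ , _ , G = rise-pathGram Π perms unique symmetric
  in All.lookup (adjacent-equal (λ π i → indicator-bit (NoDrop? (val π) i)) G 4≤n p<n i i+1<n) π∈Π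

-- A flat permutation is determined by its first ascent bit, and among three bits two agree.
flat⇒length≤2 : ∀ {n} (Π : List (Vec (Fin (suc n)) (suc n))) → All IsPerm Π → Unique Π →
  (∀ {π} → π ∈ Π → ∀ i → suc i ℕ.< n → rise π i ≡ rise π (suc i)) → length Π ℕ.≤ 2
flat⇒length≤2 []                 _                   _                                              _    = z≤n
flat⇒length≤2 (_ ∷ [])           _                   _                                              _    = s≤s z≤n
flat⇒length≤2 (_ ∷ _ ∷ [])       _                   _                                              _    = s≤s (s≤s z≤n)
flat⇒length≤2 (π₁ ∷ π₂ ∷ π₃ ∷ _) (p₁ ∷ p₂ ∷ p₃ ∷ _) ((π₁≢π₂ ∷ π₁≢π₃ ∷ _) ∷ (π₂≢π₃ ∷ _) ∷ _) flat =
  ⊥-elim (conclude (bits-coincide (bit π₁) (bit π₂) (bit π₃)))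
  where
  bit : ∀ π → Bit (rise π 0)
  bit π = indicator-bit (NoDrop? (val π) 0)
  conclude : rise π₁ 0 ≡ rise π₂ 0 ⊎ rise π₁ 0 ≡ rise π₃ 0 ⊎ rise π₂ 0 ≡ rise π₃ 0 → ⊥
  conclude (inj₁ e)        = π₁≢π₂ (flat⇒≡ p₁ p₂ (flat (here refl)) (flat (there (here refl))) e)
  conclude (inj₂ (inj₁ e)) = π₁≢π₃ (flat⇒≡ p₁ p₃ (flat (here refl)) (flat (there (there (here refl)))) e)
  conclude (inj₂ (inj₂ e)) = π₂≢π₃ (flat⇒≡ p₂ p₃ (flat (there (here refl))) (flat (there (there (here refl)))) e)

theorem1p4 : (p k : ℕ) → 3 ℕ.≤ p → p ℕ.+ 2 ℕ.≤ k →
    (Π : List (Vec (Fin k) k)) → All IsPerm Π → Unique Π → length Π ≡ p →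
    ∃ λ n → ¬ IsSymmetric Π n
theorem1p4 p k 3≤p p+2≤k Π perms unique refl with ℕₚ.≤-trans (ℕₚ.+-monoˡ-≤ 2 3≤p) p+2≤k
-- The bound k ≥ 5 exposes the form 4 + q. The witness is n = k, and p ≤ k - 2 leaves fewer patterns
-- than the k - 1 ascent columns.
... | s≤s (s≤s (s≤s (s≤s _))) = k , λ symmetric → ℕₚ.<⇒≱ 3≤p (flat⇒length≤2 Π perms unique
  (symmetric⇒flat Π perms unique (ℕₚ.≤-trans (s≤s 3≤p) p<n) p<n symmetric))
  where
  p<n : suc p ℕ.≤ ℕ.pred k
  p<n = ℕₚ.≤-pred (subst (ℕ._≤ k) (ℕₚ.+-comm p 2) p+2≤k)
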